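{- Let $a_1,a_2$ and $a_3$ be integers and let $\{U_n\}$ be the third-order recurrence sequence defined by $$U_0=0,\quad U_1=1,\quad U_2=-a_1,\qquad U_{n+3}+a_1U_{n+2}+a_2U_{n+1}+a_3U_n=0\quad (n\ge 0).$$ Let $f=x^3+a_1x^2+a_2x+a_3$ and put $D=\mathrm{disc}(f)$. Given a prime $p$ we have $$N_p(f)=\begin{cases}3 & \text{if } DU_{p-1}^2\equiv 0 \pmod p;\\ 0 & \text{if } DU_{p-1}^2\equiv (a_1^2-3a_2)^2 \pmod p;\\ 1 & \text{otherwise,}\end{cases}$$ with at most finitely many exceptions.
   Context: For a polynomial $f\in\mathbb{Z}[x]$ and a prime $p$, $N_p(f)$ denotes the number of integers $0\le a<p$ with $f(a)\equiv 0\pmod p$. $\mathrm{disc}(f)$ is the discriminant of $f$.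
   Formalization: Added, as the claim is false without it: D≠0, a_1^2≠3a_2, and D is a square if 2a_1^3-9a_1a_2+27a_3=0. Else it fails for infinitely many p: (x-1)^2(x-2) has N_p=2, not 3; for x^3-2, p≡1 mod 3, cases 3 and 0 both apply; x^3+x has N_p=1, not 3, for p≡3 mod 4. -}

module Defs where

open import Data.Fin.Base using (Fin; zero; suc; toℕ; opposite; punchIn; splitAt)
open import Data.Integer.Base
  using (ℤ; +_; 0ℤ; 1ℤ; -1ℤ; _+_; _-_; _*_; -_; _^_)
open import Data.Integer.Divisibility.Signed using (_∣_; _∣?_)
open import Data.Integer.Properties using (+-0-commutativeMonoid)
open import Data.List.Base
  using (List; []; _∷_; _++_; applyUpTo; filter; foldr; length; replicate; upTo; zipWith)
open import Data.Nat.Base as ℕ using (ℕ; zero; suc; _∸_; _/_)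
open import Data.Product.Base using (∃-syntax)
open import Data.Sum.Base using ([_,_]′)
open import Relation.Binary.PropositionalEquality.Core using (_≡_; _≢_)
open import Relation.Nullary.Decidable using (Dec)

open import Algebra.Properties.CommutativeMonoid.Sum +-0-commutativeMonoid
  using (sum)

infix 4 _≡_[mod_] _≡?_[mod_]

_≡_[mod_] : ℤ → ℤ → ℕ → Set
i ≡ j [mod p ] = + p ∣ i - j

_≡?_[mod_] : ∀ i j p → Dec (i ≡ j [mod p ])
i ≡? j [mod p ] = + p ∣? i - j

-- Coefficients are listed from the constant term upwards.
Poly : Set
Poly = List ℤ

eval : Poly → ℤ → ℤ
eval f x = foldr (λ c r → c + x * r) 0ℤ f

coeff : Poly → ℕ → ℤ
coeff []      _       = 0ℤ
coeff (c ∷ _) zero    = c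
coeff (_ ∷ f) (suc k) = coeff f k

derivative : Poly → Poly
derivative []      = []
derivative (_ ∷ f) = zipWith _*_ (applyUpTo (λ i → + suc i) (length f)) f

N : ℕ → Poly → ℕ
N p f = length (filter (λ a → eval f (+ a) ≡? 0ℤ [mod p ]) (upTo p))

Matrix : ℕ → Set
Matrix n = Fin n → Fin n → ℤ

det : ∀ {n} → Matrix n → ℤ
det {zero}  M = 1ℤ
det {suc n} M =
  sum λ j → -1ℤ ^ toℕ j * (M zero j * det λ i k → M (suc i) (punchIn j k))

-- For deg f = n and deg g = m, the rows hold the coefficients of
-- x^(m-1) f, …, f, x^(n-1) g, …, g in order of descending degree.
sylvester : ∀ n m → Poly → Poly → Matrix (m ℕ.+ n)
sylvester n m f g i j =
  coeff ([ shift f , shift g ]′ (splitAt m i)) (toℕ (opposite j))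
  where
  shift : ∀ {k} → Poly → Fin k → Poly
  shift h l = replicate (toℕ (opposite l)) 0ℤ ++ h

resultant : ∀ n m → Poly → Poly → ℤ
resultant n m f g = det (sylvester n m f g)

-- (-1)^(n(n-1)/2) Res(f, f′) for a monic polynomial f of degree n; for a
-- general f this would still have to be divided by the leading coefficient.
discMonic : ℕ → Poly → ℤ
discMonic n f =
  -1ℤ ^ (n ℕ.* (n ∸ 1) / 2) * resultant n (n ∸ 1) f (derivative f)

cubic : ℤ → ℤ → ℤ → Poly
cubic a₁ a₂ a₃ = a₃ ∷ a₂ ∷ a₁ ∷ 1ℤ ∷ []

U : ℤ → ℤ → ℤ → ℕ → ℤ
U a₁ a₂ a₃ 0                   = 0ℤ
U a₁ a₂ a₃ 1                   = 1ℤ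
U a₁ a₂ a₃ 2                   = - a₁
U a₁ a₂ a₃ (suc (suc (suc n))) =
  - (a₁ * U a₁ a₂ a₃ (suc (suc n)) + a₂ * U a₁ a₂ a₃ (suc n) + a₃ * U a₁ a₂ a₃ n)

-- Excludes exactly the cubics for which the criterion for N p f in terms of
-- D U_{p-1}² and (a₁² - 3a₂)² fails at infinitely many primes. Up to finitely
-- many p:
-- * if D = 0, then D U² = 0, but f never has three distinct roots mod p;
-- * if a₁² = 3 a₂, the congruences for "3" and "0" coincide, and hold for
--   every p ≡ 1 (mod 3);
-- * if 2a₁³ - 9a₁a₂ + 27a₃ = 27 f(-a₁/3) = 0, the roots of f are symmetric about
--   the root -a₁/3, whence U_{p-1} ≡ 0 for every p, while f has three roots
--   mod p for almost all p only if D is a square (compare x³ + x and x³ - x).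
record Nondegenerate (a₁ a₂ a₃ : ℤ) : Set where
  field
    disc≢0    : discMonic 3 (cubic a₁ a₂ a₃) ≢ 0ℤ
    a₁²≢3a₂   : a₁ ^ 2 - + 3 * a₂ ≢ 0ℤ
    symmetric : + 2 * a₁ ^ 3 - + 9 * a₁ * a₂ + + 27 * a₃ ≡ 0ℤ →
                ∃[ r ] discMonic 3 (cubic a₁ a₂ a₃) ≡ r ^ 2

{-# OPTIONS --safe #-}
module Submission where

-- Work in K = 𝔽_p[x]/(f), where U_n is the coefficient of x² in x^(n+1), and
-- write x^p = h(x) with h = A + B x + C x², so that C = U_{p-1}.
-- * If f has three roots mod p, then h(s) = s^p = s at each of them, so h(x) = x
--   and C = 0.
-- * If f has no root mod p, then K is a domain in which y = x^p and z = y^p are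
--   the two other roots of f.  Applying h to the cycle x → y → z → x yields
--   C (x - y)(y - z)(x - z) = a₁² - 3a₂, whose square is D C² = (a₁² - 3a₂)².
-- * If s is the only root and f = (x - s) g, then h(s) = s, and modulo g the
--   element x^p is the conjugate -x - (s + a₁) of x.  Hence C g(s) = 3s + a₁ and
--   D C² = disc(g) (3s + a₁)².  As disc(g) is not a square mod p, this differs
--   from (a₁² - 3a₂)², and it vanishes only if -a₁/3 is a root of f.
-- Since t^p - t = ∏ (t - i) in any ring of characteristic p, an element of a
-- domain fixed by Frobenius is one of 0, …, p - 1.

open import Defs
import Algebra.Properties.CommutativeSemiring.Binomial
import Algebra.Properties.CommutativeSemiring.Exp
import Algebra.Properties.Group
import Algebra.Properties.Semiring.Exp
import Algebra.Properties.Semiring.Mult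
import Algebra.Properties.Semiring.Sum
import Algebra.Solver.Ring
open import Algebra.Bundles using (CommutativeRing)
open import Algebra.Solver.Ring.AlmostCommutativeRing
  using (fromCommutativeRing; Induced-equivalence; _-Raw-AlmostCommutative⟶_)
open import Data.Empty using (⊥; ⊥-elim)
open import Data.Fin.Base as Fin using (Fin; toℕ; fromℕ; inject₁; opposite; punchIn; splitAt)
import Data.Fin.Properties as Fin
open import Data.Fin.Patterns
open import Data.Integer.Base as ℤ using (ℤ; +_; 0ℤ; 1ℤ; -1ℤ; ∣_∣; -[1+_])
open import Data.Integer.DivMod using (_%ℕ_; _/ℕ_; a≡a%ℕn+[a/ℕn]*n; n%ℕd<d)
open import Data.Integer.Divisibility.Signed
import Data.Integer.Properties as ℤ
open import Data.Integer.Solver using (module +-*-Solver)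
open import Data.Integer.Tactic.RingSolver using (solve-∀)
open import Data.List.Base as List using (List; []; _∷_; _++_; filter; length; upTo)
open import Data.List.Membership.Propositional using (_∈_; _∉_)
open import Data.List.Membership.Propositional.Properties using (∈-filter⁺; ∈-upTo⁺)
open import Data.List.Relation.Unary.All as All using (All; []; _∷_)
open import Data.List.Relation.Unary.All.Properties using (all-filter; filter⁺; applyUpTo⁺₁)
open import Data.List.Relation.Unary.AllPairs.Core using ([]; _∷_)
open import Data.List.Relation.Unary.Any using (here; there)
open import Data.List.Relation.Unary.Unique.Propositional using (Unique)
import Data.List.Relation.Unary.Unique.Propositional.Properties as Unique
import Data.Maybe.Base as Maybe
open import Data.Nat.Base as ℕ using (ℕ; zero; suc; _∸_; _≤_; _<_; s≤s; z≤n)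
open import Data.Nat.Combinatorics as ℕ using (k![n∸k]!∣n!; nCk≡n!/k![n-k]!; nCn≡1)
open import Data.Nat.DivMod using (m/n*n≡m)
import Data.Nat.Divisibility as ℕ∣
open import Data.Nat.GCD as GCD using (module Bézout; gcd)
open import Data.Nat.Primality
  using (Prime; euclidsLemma; prime⇒irreducible; prime⇒nonTrivial; prime⇒nonZero)
import Data.Nat.Properties as ℕ
open import Data.Product.Base using (_×_; _,_; proj₁; proj₂; ∃-syntax)
open import Data.Sum.Base using (_⊎_; inj₁; inj₂; [_,_]′)
open import Data.Vec.Base as Vec using (Vec; []; _∷_)
open import Data.Vec.Properties using (lookup-map)
open import Function.Base using (_∘_; id)
open import Level using (0ℓ)
open import Relation.Binary.Definitions using (WeaklyDecidable; tri<; tri≈; tri>)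
import Relation.Binary.PropositionalEquality as ≡
import Relation.Binary.Reasoning.Setoid
open import Relation.Nullary.Decidable using (yes; no; dec⇒maybe; _×-dec_)
open import Relation.Nullary.Negation.Core using (¬_)
open ≡ using (_≡_; _≢_)

-- Congruences modulo p

module _ {p : ℕ} where

  open import Data.Integer.Base using (_+_; _-_; _*_; -_)
  open ≡ using (refl; sym; trans; cong; subst)

  mod-reflexive : ∀ {i j} → i ≡ j → i ≡ j [mod p ]
  mod-reflexive {i} refl = divides 0ℤ (ℤ.+-inverseʳ i)

  mod-sym : ∀ {i j} → i ≡ j [mod p ] → j ≡ i [mod p ]
  mod-sym {i} {j} d = subst (+ p ∣_) (lemma i j) (∣m⇒∣-m d)
    where
    lemma : ∀ i j → - (i - j) ≡ j - i
    lemma = solve-∀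

  mod-trans : ∀ {i j k} → i ≡ j [mod p ] → j ≡ k [mod p ] → i ≡ k [mod p ]
  mod-trans {i} {j} {k} d e = subst (+ p ∣_) (lemma i j k) (∣m∣n⇒∣m+n d e)
    where
    lemma : ∀ i j k → (i - j) + (j - k) ≡ i - k
    lemma = solve-∀

  +-mod : ∀ {i j k l} → i ≡ j [mod p ] → k ≡ l [mod p ] → i + k ≡ j + l [mod p ]
  +-mod {i} {j} {k} {l} d e = subst (+ p ∣_) (lemma i j k l) (∣m∣n⇒∣m+n d e)
    where
    lemma : ∀ i j k l → (i - j) + (k - l) ≡ (i + k) - (j + l)
    lemma = solve-∀

  neg-mod : ∀ {i j} → i ≡ j [mod p ] → - i ≡ - j [mod p ]
  neg-mod {i} {j} d = subst (+ p ∣_) (lemma i j) (∣m⇒∣-m d)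
    where
    lemma : ∀ i j → - (i - j) ≡ - i - - j
    lemma = solve-∀

  *-mod : ∀ {i j k l} → i ≡ j [mod p ] → k ≡ l [mod p ] → i * k ≡ j * l [mod p ]
  *-mod {i} {j} {k} {l} d e =
    subst (+ p ∣_) (lemma i j k l) (∣m∣n⇒∣m+n (∣m⇒∣m*n k d) (∣n⇒∣m*n j e))
    where
    lemma : ∀ i j k l → (i - j) * k + j * (k - l) ≡ i * k - j * l
    lemma = solve-∀

  ∣⇒≡0 : ∀ {i} → + p ∣ i → i ≡ 0ℤ [mod p ]
  ∣⇒≡0 {i} = subst (+ p ∣_) (sym (ℤ.+-identityʳ i))

  ≡0⇒∣ : ∀ {i} → i ≡ 0ℤ [mod p ] → + p ∣ i
  ≡0⇒∣ {i} = subst (+ p ∣_) (ℤ.+-identityʳ i)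

module _ {p : ℕ} (p-prime : Prime p) where

  open import Data.Integer.Base using (_+_; _-_; _*_; -_)
  open ≡ using (sym; trans; cong; subst; module ≡-Reasoning)

  prime∣* : ∀ i j → + p ∣ i * j → (+ p ∣ i) ⊎ (+ p ∣ j)
  prime∣* i j d with euclidsLemma ∣ i ∣ ∣ j ∣ p-prime (subst (p ℕ∣.∣_) (ℤ.abs-* i j) (∣⇒∣ᵤ d))
  ... | inj₁ e = inj₁ (∣ᵤ⇒∣ e)
  ... | inj₂ e = inj₂ (∣ᵤ⇒∣ e)

  ∤*∤⇒∤ : ∀ {i j} → ¬ + p ∣ i → ¬ + p ∣ j → ¬ + p ∣ i * j
  ∤*∤⇒∤ {i} {j} p∤i p∤j d with prime∣* i j d
  ... | inj₁ e = p∤i e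
  ... | inj₂ e = p∤j e

  1<p : 1 < p
  1<p = ℕ.nonTrivial⇒n>1 p {{prime⇒nonTrivial p-prime}}

  <p⇒∤ : ∀ {n} → 0 < n → n < p → ¬ + p ∣ + n
  <p⇒∤ {suc n} _ n<p d = ℕ.<⇒≱ n<p (ℕ∣.∣⇒≤ (∣⇒∣ᵤ d))

  inverse-mod : ∀ i → ¬ + p ∣ i → ∃[ j ] j * i ≡ 1ℤ [mod p ]
  inverse-mod i p∤i = +⇒ i (bézout ∣ i ∣ λ d → p∤i (∣ᵤ⇒∣ d))
    where
    gcd≡1 : ∀ n → ¬ p ℕ∣.∣ n → gcd n p ≡ 1
    gcd≡1 n p∤n with prime⇒irreducible p-prime (GCD.gcd[m,n]∣n n p)
    ... | inj₁ e = e
    ... | inj₂ e = ⊥-elim (p∤n (subst (ℕ∣._∣ n) e (GCD.gcd[m,n]∣m n p)))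

    bézout : ∀ n → ¬ p ℕ∣.∣ n → ∃[ j ] j * + n ≡ 1ℤ [mod p ]
    bézout n p∤n with Bézout.identity (subst (GCD.GCD n p) (gcd≡1 n p∤n) (GCD.gcd-GCD n p))
    ... | Bézout.+- x y eq = + x , divides (+ y) (begin
      + x * + n - 1ℤ           ≡⟨ cong (_- 1ℤ) (ℤ.pos-* x n) ⟨
      + (x ℕ.* n) - 1ℤ         ≡⟨ cong (λ z → + z - 1ℤ) eq ⟨
      1ℤ + + (y ℕ.* p) - 1ℤ    ≡⟨ cong (λ z → 1ℤ + z - 1ℤ) (ℤ.pos-* y p) ⟩
      1ℤ + + y * + p - 1ℤ      ≡⟨ lemma (+ y) (+ p) ⟩
      + y * + p ∎)
      where
      open ≡-Reasoning
      lemma : ∀ y p → 1ℤ + y * p - 1ℤ ≡ y * p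
      lemma = solve-∀
    ... | Bézout.-+ x y eq = - + x , divides (- + y) (begin
      - + x * + n - 1ℤ           ≡⟨ lemma (+ x) (+ n) ⟩
      - (1ℤ + + x * + n)         ≡⟨ cong (λ z → - (1ℤ + z)) (ℤ.pos-* x n) ⟨
      - + (1 ℕ.+ x ℕ.* n)        ≡⟨ cong (λ z → - + z) eq ⟩
      - + (y ℕ.* p)              ≡⟨ cong -_ (ℤ.pos-* y p) ⟩
      - (+ y * + p)              ≡⟨ ℤ.neg-distribˡ-* (+ y) (+ p) ⟩
      - + y * + p ∎)
      where
      open ≡-Reasoning
      lemma : ∀ x n → - x * n - 1ℤ ≡ - (1ℤ + x * n)
      lemma = solve-∀

    +⇒ : ∀ i → ∃[ j ] j * + ∣ i ∣ ≡ 1ℤ [mod p ] → ∃[ j ] j * i ≡ 1ℤ [mod p ]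
    +⇒ (+ n)        inv     = inv
    +⇒ -[1+ n ] (j , d) = - j , subst (λ z → z ≡ 1ℤ [mod p ]) (lemma j (+ suc n)) d
      where
      lemma : ∀ j k → j * k ≡ - j * - k
      lemma = solve-∀

  residue : ∀ i → ∃[ n ] n < p × i ≡ + n [mod p ]
  residue i = i %ℕ p , n%ℕd<d i p , divides (i /ℕ p) (begin
    i - + (i %ℕ p)                                ≡⟨ cong (_- + (i %ℕ p)) (a≡a%ℕn+[a/ℕn]*n i p) ⟩
    + (i %ℕ p) + (i /ℕ p) * + p - + (i %ℕ p)      ≡⟨ lemma (+ (i %ℕ p)) ((i /ℕ p) * + p) ⟩
    (i /ℕ p) * + p ∎)
    where
    open ≡-Reasoning
    instance _ = prime⇒nonZero p-prime
    lemma : ∀ r s → r + s - r ≡ s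
    lemma = solve-∀

  p∤k! : ∀ k → k < p → ¬ p ℕ∣.∣ k ℕ.!
  p∤k! zero    k<p d = ℕ.<⇒≱ 1<p (ℕ∣.∣⇒≤ d)
  p∤k! (suc k) k<p d with euclidsLemma (suc k) (k ℕ.!) p-prime d
  ... | inj₁ e = ℕ.<⇒≱ k<p (ℕ∣.∣⇒≤ e)
  ... | inj₂ e = p∤k! k (ℕ.<-trans (ℕ.n<1+n k) k<p) e

  p∣p! : ∀ {n} → 0 < n → n ℕ∣.∣ n ℕ.!
  p∣p! {suc n} _ = ℕ∣.m∣m*n (n ℕ.!)

  pCk*k![p∸k]!≡p! : ∀ {k} → k < p → (p ℕ.C k) ℕ.* (k ℕ.! ℕ.* (p ∸ k) ℕ.!) ≡ p ℕ.!
  pCk*k![p∸k]!≡p! {k} k<p = trans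
    (cong (ℕ._* (k ℕ.! ℕ.* (p ∸ k) ℕ.!)) (nCk≡n!/k![n-k]! (ℕ.<⇒≤ k<p)))
    (m/n*n≡m (k![n∸k]!∣n! (ℕ.<⇒≤ k<p)))
    where instance _ = ℕ._!*_!≢0 k (p ∸ k)

  p∣pCk : ∀ k → 0 < k → k < p → p ℕ∣.∣ p ℕ.C k
  p∣pCk k 0<k k<p
    with euclidsLemma (p ℕ.C k) (k ℕ.! ℕ.* (p ∸ k) ℕ.!) p-prime (subst (p ℕ∣.∣_) (sym (pCk*k![p∸k]!≡p! k<p)) (p∣p! (ℕ.<-trans ℕ.z<s 1<p)))
  ... | inj₁ d = d
  ... | inj₂ d with euclidsLemma (k ℕ.!) ((p ∸ k) ℕ.!) p-prime d
  ... | inj₁ e = ⊥-elim (p∤k! k k<p e)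
  ... | inj₂ e = ⊥-elim (p∤k! (p ∸ k) (ℕ.∸-monoʳ-< 0<k (ℕ.<⇒≤ k<p)) e)

-- Rings of characteristic p

module _ (R : CommutativeRing 0ℓ 0ℓ)
  (ι-hom : ℤ.+-*-rawRing -Raw-AlmostCommutative⟶ fromCommutativeRing R) where

  open CommutativeRing R
  open _-Raw-AlmostCommutative⟶_ ι-hom renaming (⟦_⟧ to ι)

  module CharacteristicP {p : ℕ} (p-prime : Prime p) (ι-p : ι (+ p) ≈ 0#) where

    open Algebra.Properties.CommutativeSemiring.Exp commutativeSemiring public
    open Algebra.Properties.Semiring.Mult semiring using (×-homo-1) renaming (_×_ to _·_)
    open Algebra.Properties.Semiring.Sum semiring using (sum; sum-init-last; sum-cong-≋; sum-replicate-zero)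
    open Algebra.Properties.CommutativeSemiring.Binomial commutativeSemiring
      using (binomialTerm) renaming (theorem to binomial-theorem)
    open Algebra.Properties.Group +-group public
      using () renaming (x∙y⁻¹≈ε⇒x≈y to x-y≈0⇒x≈y; x≈y⇒x∙y⁻¹≈ε to x≈y⇒x-y≈0; ε⁻¹≈ε to -0#≈0#)
    open import Relation.Binary.Reasoning.Setoid setoid

    private
      coefficients-≟ : WeaklyDecidable (Induced-equivalence ι-hom)
      coefficients-≟ i j = Maybe.map (λ { ≡.refl → refl }) (dec⇒maybe (i ℤ.≟ j))

    module Solver = Algebra.Solver.Ring ℤ.+-*-rawRing (fromCommutativeRing R) ι-hom coefficients-≟
    open Solver using (solve; con; _:+_; _:*_; _:-_; :-_; _:=_)

    ι-cong : ∀ {i j} → i ≡ j [mod p ] → ι i ≈ ι j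
    ι-cong {i} {j} (divides q eq) = x-y≈0⇒x≈y _ _ (begin
      ι i - ι j            ≈⟨ +-congˡ (-‿homo j) ⟨
      ι i + ι (ℤ.- j)      ≈⟨ +-homo i (ℤ.- j) ⟨
      ι (i ℤ.- j)          ≡⟨ ≡.cong ι eq ⟩
      ι (q ℤ.* + p)        ≈⟨ *-homo q (+ p) ⟩
      ι q * ι (+ p)        ≈⟨ *-congˡ ι-p ⟩
      ι q * 0#             ≈⟨ zeroʳ (ι q) ⟩
      0#                   ∎)

    ι-cancel : ∀ {i} → ¬ + p ∣ i → ∀ w → ι i * w ≈ 0# → w ≈ 0#
    ι-cancel {i} p∤i w eq with j , inv ← inverse-mod p-prime i p∤i = begin
      w                 ≈⟨ *-identityˡ w ⟨
      1# * w            ≈⟨ *-congʳ 1-homo ⟨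
      ι 1ℤ * w          ≈⟨ *-congʳ (ι-cong inv) ⟨
      ι (j ℤ.* i) * w   ≈⟨ *-congʳ (*-homo j i) ⟩
      ι j * ι i * w     ≈⟨ *-assoc _ _ _ ⟩
      ι j * (ι i * w)   ≈⟨ *-congˡ eq ⟩
      ι j * 0#          ≈⟨ zeroʳ _ ⟩
      0#                ∎

    ·≈ι* : ∀ n x → n · x ≈ ι (+ n) * x
    ·≈ι* zero    x = sym (trans (*-congʳ 0-homo) (zeroˡ x))
    ·≈ι* (suc n) x = begin
      x + n · x              ≈⟨ +-cong (sym (*-identityˡ x)) (·≈ι* n x) ⟩
      1# * x + ι (+ n) * x   ≈⟨ distribʳ x 1# (ι (+ n)) ⟨
      (1# + ι (+ n)) * x     ≈⟨ *-congʳ (+-congʳ 1-homo) ⟨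
      (ι 1ℤ + ι (+ n)) * x   ≈⟨ *-congʳ (+-homo 1ℤ (+ n)) ⟨
      ι (+ suc n) * x        ∎

    p∣⇒·≈0 : ∀ {n} → p ℕ∣.∣ n → ∀ x → n · x ≈ 0#
    p∣⇒·≈0 {n} p∣n x = begin
      n · x         ≈⟨ ·≈ι* n x ⟩
      ι (+ n) * x   ≈⟨ *-congʳ (ι-cong {+ n} {j = 0ℤ} (∣⇒≡0 {i = + n} (∣ᵤ⇒∣ p∣n))) ⟩
      ι 0ℤ * x      ≈⟨ *-congʳ 0-homo ⟩
      0# * x        ≈⟨ zeroˡ x ⟩
      0#            ∎

    frobenius-+ : ∀ x y → (x + y) ^ p ≈ x ^ p + y ^ p
    frobenius-+ x y = go p ≡.refl
      where
      go : ∀ n → n ≡ p → (x + y) ^ n ≈ x ^ n + y ^ n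
      go zero    eq = ⊥-elim (ℕ.n≮0 (≡.subst (1 <_) (≡.sym eq) (1<p p-prime)))
      go (suc n) eq = begin
        (x + y) ^ suc n       ≈⟨ binomial-theorem (suc n) x y ⟩
        t Fin.zero + sum (λ k → t (Fin.suc k))  ≈⟨ +-congˡ (sum-init-last (λ k → t (Fin.suc k))) ⟩
        t Fin.zero + (sum (λ k → t (Fin.suc (inject₁ k))) + t (Fin.suc (fromℕ n)))
          ≈⟨ +-cong first (+-cong (trans (sum-cong-≋ middle) (sum-replicate-zero n)) last) ⟩
        y ^ suc n + (0# + x ^ suc n)   ≈⟨ trans (+-congˡ (+-identityˡ _)) (+-comm _ _) ⟩
        x ^ suc n + y ^ suc n ∎
        where
        t = binomialTerm x y (suc n)
        first : t Fin.zero ≈ y ^ suc n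
        first = trans (×-homo-1 _) (*-identityˡ _)
        middle : ∀ k → t (Fin.suc (inject₁ k)) ≈ 0#
        middle k = p∣⇒·≈0 (≡.subst (λ m → p ℕ∣.∣ m ℕ.C toℕ (Fin.suc (inject₁ k))) (≡.sym eq)
          (p∣pCk p-prime _ ℕ.z<s (≡.subst (toℕ (Fin.suc (inject₁ k)) <_) eq
            (ℕ.s<s (≡.subst (_< n) (≡.sym (Fin.toℕ-inject₁ k)) (Fin.toℕ<n k)))))) _
        last : t (Fin.suc (fromℕ n)) ≈ x ^ suc n
        last rewrite Fin.toℕ-fromℕ n | nCn≡1 (suc n) | ℕ.n∸n≡0 n =
          trans (×-homo-1 _) (*-identityʳ _)

    1^n≈1 : ∀ n → 1# ^ n ≈ 1#
    1^n≈1 zero    = refl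
    1^n≈1 (suc n) = trans (*-identityˡ _) (1^n≈1 n)

    0^p≈0 : 0# ^ p ≈ 0#
    0^p≈0 = go p (1<p p-prime)
      where
      go : ∀ n → 1 < n → 0# ^ n ≈ 0#
      go (suc n) _ = zeroˡ _

    frobenius-ι : ∀ i → ι i ^ p ≈ ι i
    frobenius-ι i with n , _ , i≡n ← residue p-prime i =
      trans (^-congˡ p (ι-cong i≡n)) (trans (fermat n) (sym (ι-cong i≡n)))
      where
      fermat : ∀ n → ι (+ n) ^ p ≈ ι (+ n)
      fermat zero    = trans (^-congˡ p 0-homo) (trans 0^p≈0 (sym 0-homo))
      fermat (suc n) = begin
        ι (+ suc n) ^ p            ≈⟨ ^-congˡ p (+-homo 1ℤ (+ n)) ⟩
        (ι 1ℤ + ι (+ n)) ^ p       ≈⟨ frobenius-+ (ι 1ℤ) (ι (+ n)) ⟩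
        ι 1ℤ ^ p + ι (+ n) ^ p     ≈⟨ +-cong (trans (^-congˡ p 1-homo) (trans (1^n≈1 p) (sym 1-homo))) (fermat n) ⟩
        ι 1ℤ + ι (+ n)             ≈⟨ +-homo 1ℤ (+ n) ⟨
        ι (+ suc n)                ∎

    monic : ∀ {n} → Vec Carrier n → Carrier → Carrier
    monic []       t = 1#
    monic (c ∷ cs) t = c + t * monic cs t

    quotient-monic : ∀ {n} → Vec Carrier (suc n) → Carrier → Vec Carrier n
    quotient-monic (c ∷ [])          r = []
    quotient-monic (c ∷ cs@(_ ∷ _)) r = monic cs r ∷ quotient-monic cs r

    factor-theorem : ∀ {n} (cs : Vec Carrier (suc n)) r t →
      monic cs t - monic cs r ≈ (t - r) * monic (quotient-monic cs r) t
    factor-theorem (c ∷ []) r t =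
      solve 4 (λ c r t i → (c :+ t :* i) :- (c :+ r :* i) := (t :- r) :* i) refl c r t 1#
    factor-theorem (c ∷ cs@(_ ∷ _)) r t = begin
      (c + t * mt) - (c + r * mr)       ≈⟨ solve 5 (λ c r t mr mt →
        (c :+ t :* mt) :- (c :+ r :* mr) := (t :- r) :* mr :+ t :* (mt :- mr)) refl c r t mr mt ⟩
      (t - r) * mr + t * (mt - mr)      ≈⟨ +-congˡ (*-congˡ (factor-theorem cs r t)) ⟩
      (t - r) * mr + t * ((t - r) * q)  ≈⟨ solve 4 (λ r t mr q →
        (t :- r) :* mr :+ t :* ((t :- r) :* q) := (t :- r) :* (mr :+ t :* q)) refl r t mr q ⟩
      (t - r) * (mr + t * q)            ∎
      where
      mt = monic cs t
      mr = monic cs r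
      q  = monic (quotient-monic cs r) t

    ∏[t-_] : (ℕ → Carrier) → ℕ → Carrier → Carrier
    ∏[t- r ] zero    t = 1#
    ∏[t- r ] (suc n) t = (t - r n) * ∏[t- r ] n t

    monic-splits : ∀ {n} (cs : Vec Carrier n) (r : ℕ → Carrier) →
      (∀ {i j} → i < j → j < n → ∀ w → (r i - r j) * w ≈ 0# → w ≈ 0#) →
      (∀ {i} → i < n → monic cs (r i) ≈ 0#) →
      ∀ t → monic cs t ≈ ∏[t- r ] n t
    monic-splits [] r cancel root t = refl
    monic-splits {suc n} cs@(_ ∷ _) r cancel root t = begin
      monic cs t                                 ≈⟨ factor t ⟩
      (t - r n) * monic (quotient-monic cs (r n)) t
        ≈⟨ *-congˡ (monic-splits (quotient-monic cs (r n)) r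
             (λ i<j j<n → cancel i<j (ℕ.m<n⇒m<1+n j<n))
             (λ {i} i<n → cancel i<n (ℕ.n<1+n n) _ (trans (sym (factor (r i))) (root (ℕ.m<n⇒m<1+n i<n))))
             t) ⟩
      (t - r n) * ∏[t- r ] n t                   ∎
      where
      factor : ∀ t → monic cs t ≈ (t - r n) * monic (quotient-monic cs (r n)) t
      factor t = begin
        monic cs t                       ≈⟨ solve 1 (λ m → m := m :- con 0ℤ) refl _ ⟩
        monic cs t - ι 0ℤ                ≈⟨ +-congˡ (-‿cong (trans 0-homo (sym (root (ℕ.n<1+n n))))) ⟩
        monic cs t - monic cs (r n)      ≈⟨ factor-theorem cs (r n) t ⟩
        (t - r n) * monic (quotient-monic cs (r n)) t ∎

    monic-replicate-0 : ∀ n t → monic (Vec.replicate n 0#) t ≈ t ^ n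
    monic-replicate-0 zero    t = refl
    monic-replicate-0 (suc n) t = trans (+-identityˡ _) (*-congˡ (monic-replicate-0 n t))

    fermat-factorisation : ∀ t → t ^ p - t ≈ ∏[t- (λ i → ι (+ i)) ] p t
    fermat-factorisation = go p (1<p p-prime) ≡.refl
      where
      go : ∀ n → 1 < n → n ≡ p → ∀ t → t ^ n - t ≈ ∏[t- (λ i → ι (+ i)) ] n t
      go (suc zero)    (ℕ.s≤s ())
      go (suc (suc n)) _ eq t = trans (sym (value t)) (monic-splits coeffs _ cancel root t)
        where
        coeffs = 0# ∷ - 1# ∷ Vec.replicate n 0#

        value : ∀ t → monic coeffs t ≈ t ^ suc (suc n) - t
        value t = trans
          (+-congˡ (*-congˡ (+-congˡ (*-congˡ (monic-replicate-0 n t)))))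
          (trans (+-congʳ (sym 0-homo)) (trans (+-congˡ (*-congˡ (+-congʳ (-‿cong (sym 1-homo)))))
          (solve 2 (λ t s → con 0ℤ :+ t :* ((:- con 1ℤ) :+ t :* s) := t :* (t :* s) :- t) refl t (t ^ n))))

        cancel : ∀ {i j} → i < j → j < suc (suc n) → ∀ w → (ι (+ i) - ι (+ j)) * w ≈ 0# → w ≈ 0#
        cancel {i} {j} i<j j<n w w≈0 = ι-cancel
          (<p⇒∤ p-prime (ℕ.m<n⇒0<n∸m i<j) (≡.subst (j ∸ i <_) eq (ℕ.≤-<-trans (ℕ.m∸n≤m j i) j<n)))
          w (begin
          ι (+ (j ∸ i)) * w              ≡⟨ ≡.cong (λ k → ι k * w) (ℤ.⊖-≥ (ℕ.<⇒≤ i<j)) ⟨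
          ι (j ℤ.⊖ i) * w                ≡⟨ ≡.cong (λ k → ι k * w) (ℤ.m-n≡m⊖n j i) ⟨
          ι (+ j ℤ.- + i) * w            ≈⟨ *-congʳ (trans (+-homo _ _) (+-congˡ (-‿homo _))) ⟩
          (ι (+ j) - ι (+ i)) * w        ≈⟨ solve 3 (λ i j w → (j :- i) :* w := :- ((i :- j) :* w)) refl _ _ w ⟩
          - ((ι (+ i) - ι (+ j)) * w)    ≈⟨ -‿cong w≈0 ⟩
          - 0#                           ≈⟨ -0#≈0# ⟩
          0#                             ∎)

        root : ∀ {i} → i < suc (suc n) → monic coeffs (ι (+ i)) ≈ 0#
        root {i} _ = trans (value (ι (+ i)))
          (x≈y⇒x-y≈0 (≡.subst (λ m → ι (+ i) ^ m ≈ ι (+ i)) (≡.sym eq) (frobenius-ι (+ i))))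

    fermat-elim : ∀ y (P : Carrier → Set) → (∀ {v w} → v ≈ w → P v → P w) →
      (∀ {i} → i < p → ∀ w → P ((y - ι (+ i)) * w) → P w) → P (y ^ p - y) → P 1#
    fermat-elim y P resp divide Py =
      go p ℕ.≤-refl (resp (fermat-factorisation y) Py)
      where
      go : ∀ n → n ≤ p → P (∏[t- (λ i → ι (+ i)) ] n y) → P 1#
      go zero    _   P1 = P1
      go (suc n) n<p Pw = go n (ℕ.<⇒≤ n<p) (divide n<p _ Pw)

    open Solver using (Polynomial; op; [+]; [*]; var; _:^_; ⟦_⟧)

    ⟦_⟧ℤ : ∀ {n} → Polynomial n → Vec ℤ n → ℤ
    ⟦ op [+] P Q ⟧ℤ i = ⟦ P ⟧ℤ i ℤ.+ ⟦ Q ⟧ℤ i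
    ⟦ op [*] P Q ⟧ℤ i = ⟦ P ⟧ℤ i ℤ.* ⟦ Q ⟧ℤ i
    ⟦ con c ⟧ℤ      i = c
    ⟦ var k ⟧ℤ      i = Vec.lookup i k
    ⟦ P :^ n ⟧ℤ     i = ⟦ P ⟧ℤ i ℤ.^ n
    ⟦ :- P ⟧ℤ       i = ℤ.- ⟦ P ⟧ℤ i

    ι-⟦⟧ : ∀ {n} (P : Polynomial n) i → ι (⟦ P ⟧ℤ i) ≈ ⟦ P ⟧ (Vec.map ι i)
    ι-⟦⟧ (op [+] P Q) i = trans (+-homo _ _) (+-cong (ι-⟦⟧ P i) (ι-⟦⟧ Q i))
    ι-⟦⟧ (op [*] P Q) i = trans (*-homo _ _) (*-cong (ι-⟦⟧ P i) (ι-⟦⟧ Q i))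
    ι-⟦⟧ (con c)      i = refl
    ι-⟦⟧ (var k)      i = reflexive (≡.sym (lookup-map k ι i))
    ι-⟦⟧ (P :^ n)     i = trans (ι-^ n) (^-congˡ n (ι-⟦⟧ P i))
      where
      ι-^ : ∀ {j} n → ι (j ℤ.^ n) ≈ ι j ^ n
      ι-^ zero    = 1-homo
      ι-^ (suc n) = trans (*-homo _ _) (*-congˡ (ι-^ n))
    ι-⟦⟧ (:- P)       i = trans (-‿homo _) (-‿cong (ι-⟦⟧ P i))

    ⟦⟧-cong : ∀ {n} (P : Polynomial n) (u v : Vec Carrier n) →
      (∀ k → Vec.lookup u k ≈ Vec.lookup v k) → ⟦ P ⟧ u ≈ ⟦ P ⟧ v
    ⟦⟧-cong (op [+] P Q) u v u≈v = +-cong (⟦⟧-cong P u v u≈v) (⟦⟧-cong Q u v u≈v)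
    ⟦⟧-cong (op [*] P Q) u v u≈v = *-cong (⟦⟧-cong P u v u≈v) (⟦⟧-cong Q u v u≈v)
    ⟦⟧-cong (con c) u v u≈v = refl
    ⟦⟧-cong (var k) u v u≈v = u≈v k
    ⟦⟧-cong (P :^ n) u v u≈v = ^-congˡ n (⟦⟧-cong P u v u≈v)
    ⟦⟧-cong (:- P) u v u≈v = -‿cong (⟦⟧-cong P u v u≈v)

-- Cubic extensions of 𝔽_p

cubicℤ : ℤ → ℤ → ℤ → ℤ → ℤ
cubicℤ a b c t = t ℤ.* t ℤ.* t ℤ.+ a ℤ.* (t ℤ.* t) ℤ.+ b ℤ.* t ℤ.+ c

discriminant : ℤ → ℤ → ℤ → ℤ
discriminant a b c =
  a ℤ.* a ℤ.* (b ℤ.* b) ℤ.- + 4 ℤ.* (b ℤ.* b ℤ.* b) ℤ.- + 4 ℤ.* (a ℤ.* a ℤ.* a ℤ.* c)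
    ℤ.+ + 18 ℤ.* (a ℤ.* b ℤ.* c) ℤ.- + 27 ℤ.* (c ℤ.* c)

module _ {p : ℕ} (p-prime : Prime p) (p∤2 : ¬ + p ∣ + 2) where

  halve : ∀ i → + p ∣ + 2 ℤ.* i → + p ∣ i
  halve i = [ ⊥-elim ∘ p∤2 , id ]′ ∘ prime∣* p-prime (+ 2) i

  -- For P + Q x modulo the irreducible quadratic x² + u x + v, the
  -- hypotheses say that it is a root of this quadratic.
  quadratic-conjugates : ∀ P Q u v →
    (∀ t → ¬ + p ∣ t ℤ.* t ℤ.+ u ℤ.* t ℤ.+ v) →
    ¬ + p ∣ u ℤ.* u ℤ.- + 4 ℤ.* v →
    + p ∣ P ℤ.* P ℤ.+ u ℤ.* P ℤ.+ v ℤ.- v ℤ.* (Q ℤ.* Q) →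
    + p ∣ Q ℤ.* (+ 2 ℤ.* P ℤ.- u ℤ.* Q ℤ.+ u) →
    ((+ p ∣ P) × (+ p ∣ Q ℤ.- 1ℤ)) ⊎ ((+ p ∣ P ℤ.+ u) × (+ p ∣ Q ℤ.+ 1ℤ))
  quadratic-conjugates P Q u v rootless p∤δ p∣c₀ p∣c₁ =
    [ (λ p∣Q → ⊥-elim (rootless P (≡.subst (+ p ∣_) (lemma₁ P Q u v)
        (∣m∣n⇒∣m+n p∣c₀ (∣n⇒∣m*n (v ℤ.* Q) p∣Q)))))
    , nonconstant
    ]′ (prime∣* p-prime Q k p∣c₁)
    where
    k : ℤ
    k = + 2 ℤ.* P ℤ.- u ℤ.* Q ℤ.+ u
    lemma₁ : ∀ P Q u v →
      (P ℤ.* P ℤ.+ u ℤ.* P ℤ.+ v ℤ.- v ℤ.* (Q ℤ.* Q)) ℤ.+ v ℤ.* Q ℤ.* Q ≡ P ℤ.* P ℤ.+ u ℤ.* P ℤ.+ v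
    lemma₁ = solve-∀
    lemma₂ : ∀ P Q u v → let k = + 2 ℤ.* P ℤ.- u ℤ.* Q ℤ.+ u in
      + 4 ℤ.* (P ℤ.* P ℤ.+ u ℤ.* P ℤ.+ v ℤ.- v ℤ.* (Q ℤ.* Q)) ℤ.-
      k ℤ.* (k ℤ.+ + 2 ℤ.* (u ℤ.* Q)) ≡
      (u ℤ.* u ℤ.- + 4 ℤ.* v) ℤ.* ((Q ℤ.- 1ℤ) ℤ.* (Q ℤ.+ 1ℤ))
    lemma₂ = solve-∀
    lemma₃ : ∀ P Q u → (+ 2 ℤ.* P ℤ.- u ℤ.* Q ℤ.+ u) ℤ.+ u ℤ.* (Q ℤ.- 1ℤ) ≡ + 2 ℤ.* P
    lemma₃ = solve-∀
    lemma₄ : ∀ P Q u → (+ 2 ℤ.* P ℤ.- u ℤ.* Q ℤ.+ u) ℤ.+ u ℤ.* (Q ℤ.+ 1ℤ) ≡ + 2 ℤ.* (P ℤ.+ u)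
    lemma₄ = solve-∀
    nonconstant : + p ∣ k → ((+ p ∣ P) × (+ p ∣ Q ℤ.- 1ℤ)) ⊎ ((+ p ∣ P ℤ.+ u) × (+ p ∣ Q ℤ.+ 1ℤ))
    nonconstant p∣k =
      [ (λ p∣δ → ⊥-elim (p∤δ p∣δ))
      , [ (λ p∣Q-1 → inj₁ (halve P (≡.subst (+ p ∣_) (lemma₃ P Q u)
            (∣m∣n⇒∣m+n p∣k (∣n⇒∣m*n u p∣Q-1))) , p∣Q-1))
        , (λ p∣Q+1 → inj₂ (halve (P ℤ.+ u) (≡.subst (+ p ∣_) (lemma₄ P Q u)
            (∣m∣n⇒∣m+n p∣k (∣n⇒∣m*n u p∣Q+1))) , p∣Q+1))
        ]′ ∘ prime∣* p-prime (Q ℤ.- 1ℤ) (Q ℤ.+ 1ℤ)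
      ]′ (prime∣* p-prime (u ℤ.* u ℤ.- + 4 ℤ.* v) ((Q ℤ.- 1ℤ) ℤ.* (Q ℤ.+ 1ℤ))
        (≡.subst (+ p ∣_) (lemma₂ P Q u v)
          (∣m∣n⇒∣m-n (∣n⇒∣m*n (+ 4) p∣c₀) (∣m⇒∣m*n (k ℤ.+ + 2 ℤ.* (u ℤ.* Q)) p∣k))))

module _ (R : CommutativeRing 0ℓ 0ℓ)
  (ι-hom : ℤ.+-*-rawRing -Raw-AlmostCommutative⟶ fromCommutativeRing R) where

  open CommutativeRing R
  open _-Raw-AlmostCommutative⟶_ ι-hom renaming (⟦_⟧ to ι)

  module CubicExtension {p : ℕ} (p-prime : Prime p) (ι-p : ι (+ p) ≈ 0#) (a b c : ℤ) (x : Carrier)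
    (x-root : x * x * x + ι a * (x * x) + ι b * x + ι c ≈ 0#)
    (independent : ∀ A B C → ι A + ι B * x + ι C * (x * x) ≈ 0# → (+ p ∣ A) × (+ p ∣ B) × (+ p ∣ C))
    where

    open CharacteristicP R ι-hom p-prime ι-p
    open Solver
    open import Relation.Binary.Reasoning.Setoid setoid

    private
      F : ℤ → ℤ
      F = cubicℤ a b c

      f : Carrier → Carrier
      f t = t * t * t + ι a * (t * t) + ι b * t + ι c

    infixr 5 _⊕_
    _⊕_ : ∀ {u v} → u ≈ 0# → v ≈ 0# → u + v ≈ 0#
    u≈0 ⊕ v≈0 = trans (+-cong u≈0 v≈0) (+-identityˡ 0#)

    infix 6 _⊛_
    _⊛_ : ∀ w {u} → u ≈ 0# → w * u ≈ 0#
    w ⊛ u≈0 = trans (*-congˡ u≈0) (zeroʳ w)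

    ∣⇒ι≈0 : ∀ {i} → + p ∣ i → ι i ≈ 0#
    ∣⇒ι≈0 {i} d = trans (ι-cong {i} {0ℤ} (∣⇒≡0 d)) 0-homo

    independent-⟦⟧ : ∀ {n} (P Q S : Polynomial n) (i : Vec ℤ n) →
      ⟦ P ⟧ (Vec.map ι i) + ⟦ Q ⟧ (Vec.map ι i) * x + ⟦ S ⟧ (Vec.map ι i) * (x * x) ≈ 0# →
      (+ p ∣ ⟦ P ⟧ℤ i) × (+ p ∣ ⟦ Q ⟧ℤ i) × (+ p ∣ ⟦ S ⟧ℤ i)
    independent-⟦⟧ P Q S i eq = independent (⟦ P ⟧ℤ i) (⟦ Q ⟧ℤ i) (⟦ S ⟧ℤ i) (trans
      (+-cong (+-cong (ι-⟦⟧ P i) (*-congʳ (ι-⟦⟧ Q i))) (*-congʳ (ι-⟦⟧ S i))) eq)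

    ι-F : ∀ t → ι (F t) ≈ f (ι t)
    ι-F t = ι-⟦⟧ (var₀ :* var₀ :* var₀ :+ a′ :* (var₀ :* var₀) :+ b′ :* var₀ :+ c′) (t ∷ a ∷ b ∷ c ∷ [])
      where
      var₀ a′ b′ c′ : Polynomial 4
      var₀ = var 0F
      a′ = var 1F
      b′ = var 2F
      c′ = var 3F

    x-s-cancel : ∀ s → ¬ + p ∣ F s → ∀ w → (x - ι s) * w ≈ 0# → w ≈ 0#
    x-s-cancel s p∤Fs w eq = ι-cancel p∤Fs w (begin
      ι (F s) * w       ≈⟨ *-congʳ (ι-F s) ⟩
      f (ι s) * w       ≈⟨ solve 6 (λ x s a b c w →
        (s :* s :* s :+ a :* (s :* s) :+ b :* s :+ c) :* w :=
        w :* (x :* x :* x :+ a :* (x :* x) :+ b :* x :+ c) :+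
        (:- (x :* x :+ (s :+ a) :* x :+ (s :* s :+ a :* s :+ b))) :* ((x :- s) :* w))
        refl x (ι s) (ι a) (ι b) (ι c) w ⟩
      w * f x + - (x * x + (ι s + ι a) * x + (ι s * ι s + ι a * ι s + ι b)) * ((x - ι s) * w)
                        ≈⟨ w ⊛ x-root ⊕ _ ⊛ eq ⟩
      0#                ∎)

    ^p-factor : ∀ t → ∃[ w ] t ^ p ≈ t * w
    ^p-factor t = go p (1<p p-prime)
      where
      go : ∀ n → 1 < n → ∃[ w ] t ^ n ≈ t * w
      go (suc n) _ = t ^ n , refl

    -- Both sides of x^p = h(x) are compared at the root s by multiplying
    -- with f(x)/(x - s), which is an eigenvector for x with eigenvalue s.
    frobenius-at-root : ∀ {A B C} → x ^ p ≈ ι A + ι B * x + ι C * (x * x) →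
      ∀ s → + p ∣ F s → + p ∣ A ℤ.+ B ℤ.* s ℤ.+ C ℤ.* (s ℤ.* s) ℤ.- s
    frobenius-at-root {A} {B} {C} x^p≈ s p∣Fs
      with w , fac ← ^p-factor (x - ι s) =
      proj₂ (proj₂ (independent-⟦⟧
        (V :* (s′ :* s′ :+ a′ :* s′ :+ b′)) (V :* (s′ :+ a′)) V
        (A ∷ B ∷ C ∷ s ∷ a ∷ b ∷ []) (begin
          _ ≈⟨ solve 8 (λ A B C s a b c x →
            let V = A :+ B :* s :+ C :* (s :* s) :- s
                g = x :* x :+ (s :+ a) :* x :+ (s :* s :+ a :* s :+ b)
            in V :* (s :* s :+ a :* s :+ b) :+ V :* (s :+ a) :* x :+ V :* (x :* x) :=
              g :* (A :+ B :* x :+ C :* (x :* x) :- s) :+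
              (:- (B :+ C :* (x :+ s))) :*
               ((x :* x :* x :+ a :* (x :* x) :+ b :* x :+ c) :-
                (s :* s :* s :+ a :* (s :* s) :+ b :* s :+ c)))
              refl (ι A) (ι B) (ι C) (ι s) (ι a) (ι b) (ι c) x ⟩
          g * (ι A + ι B * x + ι C * (x * x) - ι s) + - (ι B + ι C * (x + ι s)) * (f x - f (ι s))
            ≈⟨ +-cong (*-congˡ value) (_ ⊛ f≈f) ⟩
          g * ((x - ι s) * w) + 0#
            ≈⟨ solve 7 (λ x s a b c w z →
               (x :* x :+ (s :+ a) :* x :+ (s :* s :+ a :* s :+ b)) :* ((x :- s) :* w) :+ z :=
               w :* ((x :* x :* x :+ a :* (x :* x) :+ b :* x :+ c) :-
                (s :* s :* s :+ a :* (s :* s) :+ b :* s :+ c)) :+ z)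
                refl x (ι s) (ι a) (ι b) (ι c) w 0# ⟩
          w * (f x - f (ι s)) + 0#
            ≈⟨ w ⊛ f≈f ⊕ refl ⟩
          0# ∎)))
      where
      s′ a′ b′ V : Polynomial 6
      s′ = var 3F
      a′ = var 4F
      b′ = var 5F
      V = var 0F :+ var 1F :* s′ :+ var 2F :* (s′ :* s′) :- s′
      g = x * x + (ι s + ι a) * x + (ι s * ι s + ι a * ι s + ι b)
      f≈f : f x - f (ι s) ≈ 0#
      f≈f = x≈y⇒x-y≈0 (trans x-root (sym (trans (sym (ι-F s)) (∣⇒ι≈0 p∣Fs))))
      value : ι A + ι B * x + ι C * (x * x) - ι s ≈ (x - ι s) * w
      value = begin
        ι A + ι B * x + ι C * (x * x) - ι s   ≈⟨ +-congʳ x^p≈ ⟨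
        x ^ p - ι s                     ≈⟨ +-congʳ (^-congˡ p (solve 2 (λ x s → x := (x :- s) :+ s) refl x (ι s))) ⟩
        (x - ι s + ι s) ^ p - ι s       ≈⟨ +-congʳ (frobenius-+ (x - ι s) (ι s)) ⟩
        (x - ι s) ^ p + ι s ^ p - ι s   ≈⟨ +-congʳ (+-cong fac (frobenius-ι s)) ⟩
        (x - ι s) * w + ι s - ι s       ≈⟨ solve 2 (λ u s → u :+ s :- s := u) refl _ _ ⟩
        (x - ι s) * w                   ∎

    module _ (s : ℤ) (p∣Fs : + p ∣ F s) where

      private
        f≈0 : f (ι s) ≈ 0#
        f≈0 = trans (sym (ι-F s)) (∣⇒ι≈0 p∣Fs)

        g : Carrier → Carrier
        g t = t * t + (ι s + ι a) * t + (ι s * ι s + ι a * ι s + ι b)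

      frobenius-g : g x ^ p ≈ g (x ^ p)
      frobenius-g = trans (frobenius-+ _ _) (+-cong
        (trans (frobenius-+ _ _) (+-cong
          (^-distrib-* x x p)
          (trans (^-distrib-* _ _ p) (*-congʳ (trans (^-congˡ p (sym (+-homo s a))) (trans (frobenius-ι _) (+-homo s a)))))))
        (trans (^-congˡ p (sym v)) (trans (frobenius-ι _) v)))
        where
        v : ι (s ℤ.* s ℤ.+ a ℤ.* s ℤ.+ b) ≈ ι s * ι s + ι a * ι s + ι b
        v = trans (+-homo _ _) (+-congʳ (trans (+-homo _ _) (+-cong (*-homo _ _) (*-homo _ _))))

      [x-s]g[x]≈0 : (x - ι s) * g x ≈ 0#
      [x-s]g[x]≈0 = trans (solve 5 (λ x s a b c →
        (x :- s) :* (x :* x :+ (s :+ a) :* x :+ (s :* s :+ a :* s :+ b)) :=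
        (x :* x :* x :+ a :* (x :* x) :+ b :* x :+ c) :-
        (s :* s :* s :+ a :* (s :* s) :+ b :* s :+ c)) refl x (ι s) (ι a) (ι b) (ι c))
        (x≈y⇒x-y≈0 (trans x-root (sym f≈0)))

      [x-s]g[x^p]≈0 : (x - ι s) * g (x ^ p) ≈ 0#
      [x-s]g[x^p]≈0 with w , fac ← ^p-factor (g x) = begin
        (x - ι s) * g (x ^ p)     ≈⟨ *-congˡ (trans (sym frobenius-g) fac) ⟩
        (x - ι s) * (g x * w)     ≈⟨ *-assoc _ _ _ ⟨
        (x - ι s) * g x * w       ≈⟨ *-congʳ [x-s]g[x]≈0 ⟩
        0# * w                    ≈⟨ zeroˡ w ⟩
        0#                        ∎

      module _ (unique : ∀ t → + p ∣ F t → + p ∣ t ℤ.- s)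
        (p∤G : ¬ + p ∣ (+ 3) ℤ.* (s ℤ.* s) ℤ.+ (+ 2) ℤ.* (a ℤ.* s) ℤ.+ b) where

        private
          ι-G : ι ((+ 3) ℤ.* (s ℤ.* s) ℤ.+ (+ 2) ℤ.* (a ℤ.* s) ℤ.+ b) ≈
            ι (+ 3) * (ι s * ι s) + ι (+ 2) * (ι a * ι s) + ι b
          ι-G = trans (+-homo _ _) (+-congʳ (trans (+-homo _ _) (+-cong
            (trans (*-homo _ _) (*-congˡ (*-homo _ _))) (trans (*-homo _ _) (*-congˡ (*-homo _ _))))))

        x-s-reduced : ∀ w → (x - ι s) * ((x - ι s) * w) ≈ 0# → (x - ι s) * w ≈ 0#
        x-s-reduced w eq = ι-cancel p∤G _ (begin
          _  ≈⟨ *-congʳ ι-G ⟩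
          _  ≈⟨ solve 5 (λ x s a b w →
            (con (+ 3) :* (s :* s) :+ con (+ 2) :* (a :* s) :+ b) :* ((x :- s) :* w) :=
            w :* ((x :- s) :* (x :* x :+ (s :+ a) :* x :+ (s :* s :+ a :* s :+ b))) :+
            (:- (x :+ s :+ s :+ a)) :* ((x :- s) :* ((x :- s) :* w))) refl x (ι s) (ι a) (ι b) w ⟩
          _  ≈⟨ w ⊛ [x-s]g[x]≈0 ⊕ _ ⊛ eq ⟩
          0# ∎)

        x^p≉x : ¬ (x - ι s) * (x ^ p - x) ≈ 0#
        x^p≉x eq with independent-⟦⟧ (:- var 0F) (con 1ℤ) (con 0ℤ) (s ∷ []) (begin
            _            ≈⟨ solve 2 (λ x s → (:- s) :+ con 1ℤ :* x :+ con 0ℤ :* (x :* x) := (x :- s) :* con 1ℤ) refl x (ι s) ⟩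
            (x - ι s) * ι 1ℤ   ≈⟨ *-congˡ 1-homo ⟩
            (x - ι s) * 1#  ≈⟨ fermat-elim x (λ w → (x - ι s) * w ≈ 0#) (λ v≈w → trans (*-congˡ (sym v≈w))) divide eq ⟩
            0#              ∎)
          where
          divide : ∀ {i} → i < p → ∀ w → (x - ι s) * ((x - ι (+ i)) * w) ≈ 0# → (x - ι s) * w ≈ 0#
          divide {i} _ w e with + p ∣? F (+ i)
          ... | yes p∣Fi = x-s-reduced w (trans
            (*-congˡ (*-congʳ (+-congˡ (-‿cong (ι-cong {s} {+ i} (mod-sym {i = + i} {j = s} (unique (+ i) p∣Fi))))))) e)
          ... | no  p∤Fi = x-s-cancel (+ i) p∤Fi _ (trans (solve 4 (λ x s i w →
             (x :- i) :* ((x :- s) :* w) := (x :- s) :* ((x :- i) :* w)) refl _ _ _ _) e)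
        ... | _ , p∣1 , _ = <p⇒∤ p-prime ℕ.z<s (1<p p-prime) p∣1

        g-rootless : ∀ t → ¬ + p ∣ t ℤ.* t ℤ.+ (s ℤ.+ a) ℤ.* t ℤ.+ (s ℤ.* s ℤ.+ a ℤ.* s ℤ.+ b)
        g-rootless t d = p∤G (≡.subst (+ p ∣_) (lemma₂ s t a b)
          (∣m∣n⇒∣m-n d (∣m⇒∣m*n (t ℤ.+ s ℤ.+ s ℤ.+ a) (unique t
            (≡.subst (+ p ∣_) (lemma₁ s t a b c) (∣m∣n⇒∣m+n (∣n⇒∣m*n (t ℤ.- s) d) p∣Fs))))))
          where
          lemma₁ : ∀ s t a b c →
            (t ℤ.- s) ℤ.* (t ℤ.* t ℤ.+ (s ℤ.+ a) ℤ.* t ℤ.+ (s ℤ.* s ℤ.+ a ℤ.* s ℤ.+ b)) ℤ.+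
            (s ℤ.* s ℤ.* s ℤ.+ a ℤ.* (s ℤ.* s) ℤ.+ b ℤ.* s ℤ.+ c) ≡
            t ℤ.* t ℤ.* t ℤ.+ a ℤ.* (t ℤ.* t) ℤ.+ b ℤ.* t ℤ.+ c
          lemma₁ = solve-∀
          lemma₂ : ∀ s t a b →
            (t ℤ.* t ℤ.+ (s ℤ.+ a) ℤ.* t ℤ.+ (s ℤ.* s ℤ.+ a ℤ.* s ℤ.+ b)) ℤ.-
            (t ℤ.- s) ℤ.* (t ℤ.+ s ℤ.+ s ℤ.+ a) ≡
            + 3 ℤ.* (s ℤ.* s) ℤ.+ + 2 ℤ.* (a ℤ.* s) ℤ.+ b
          lemma₂ = solve-∀

        -- A relation δ m² ≡ n² with m ≢ 0 makes the discriminant δ of g a square.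
        δm²≢n² : ¬ + p ∣ + 2 → ∀ m n → ¬ + p ∣ m →
          ¬ + p ∣ ((s ℤ.+ a) ℤ.* (s ℤ.+ a) ℤ.- + 4 ℤ.* (s ℤ.* s ℤ.+ a ℤ.* s ℤ.+ b)) ℤ.* (m ℤ.* m) ℤ.- n ℤ.* n
        δm²≢n² p∤2 m n p∤m d with j , divides q eq ← inverse-mod p-prime (+ 2 ℤ.* m) (∤*∤⇒∤ p-prime p∤2 p∤m) =
          [ [ p∤2 , p∤2 ]′ ∘ prime∣* p-prime (+ 2) (+ 2)
          , [ [ p∤m , p∤m ]′ ∘ prime∣* p-prime m m , g-rootless t ]′ ∘ prime∣* p-prime (m ℤ.* m) _
          ]′ (prime∣* p-prime (+ 4) _ (≡.subst (+ p ∣_) (lemma j m n (s ℤ.+ a) (s ℤ.* s ℤ.+ a ℤ.* s ℤ.+ b))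
            (∣m∣n⇒∣m-n (∣m⇒∣m*n k (divides q eq)) d)))
          where
          u t k : ℤ
          u = s ℤ.+ a
          t = j ℤ.* (n ℤ.- u ℤ.* m)
          k = (n ℤ.- u ℤ.* m) ℤ.* ((j ℤ.* (+ 2 ℤ.* m) ℤ.- 1ℤ) ℤ.* (n ℤ.- u ℤ.* m) ℤ.+ + 2 ℤ.* n)
          lemma : ∀ j m n u v → let w = n ℤ.- u ℤ.* m ; t = j ℤ.* w in
            (j ℤ.* (+ 2 ℤ.* m) ℤ.- 1ℤ) ℤ.* (w ℤ.* ((j ℤ.* (+ 2 ℤ.* m) ℤ.- 1ℤ) ℤ.* w ℤ.+ + 2 ℤ.* n)) ℤ.-
            ((u ℤ.* u ℤ.- + 4 ℤ.* v) ℤ.* (m ℤ.* m) ℤ.- n ℤ.* n) ≡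
            + 4 ℤ.* (m ℤ.* m ℤ.* (t ℤ.* t ℤ.+ u ℤ.* t ℤ.+ v))
          lemma = solve-∀

        δ-unit : ¬ + p ∣ + 2 → ¬ + p ∣ (s ℤ.+ a) ℤ.* (s ℤ.+ a) ℤ.- + 4 ℤ.* (s ℤ.* s ℤ.+ a ℤ.* s ℤ.+ b)
        δ-unit p∤2 d = δm²≢n² p∤2 1ℤ 0ℤ (<p⇒∤ p-prime ℕ.z<s (1<p p-prime)) (≡.subst (+ p ∣_) (lemma _) d)
          where
          lemma : ∀ δ → δ ≡ δ ℤ.* (1ℤ ℤ.* 1ℤ) ℤ.- 0ℤ ℤ.* 0ℤ
          lemma = solve-∀

        module _ {P Q C : ℤ} (x^p≈ : x ^ p ≈ ι P + ι Q * x + ι C * g x) where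

          private
            u v c₀ c₁ : ℤ
            u = s ℤ.+ a
            v = s ℤ.* s ℤ.+ a ℤ.* s ℤ.+ b
            c₀ = P ℤ.* P ℤ.+ u ℤ.* P ℤ.+ v ℤ.- v ℤ.* (Q ℤ.* Q)
            c₁ = Q ℤ.* (+ 2 ℤ.* P ℤ.- u ℤ.* Q ℤ.+ u)

          conjugate-equations : (+ p ∣ c₀) × (+ p ∣ c₁)
          conjugate-equations =
            ≡.subst (+ p ∣_) (lemma c₀ c₁ s) 
              (∣m∣n⇒∣m+n (proj₁ (proj₂ coefficients)) (∣n⇒∣m*n s (proj₂ (proj₂ coefficients)))) ,
            proj₂ (proj₂ coefficients)
            where
            lemma : ∀ c₀ c₁ s → (c₀ ℤ.- s ℤ.* c₁) ℤ.+ s ℤ.* c₁ ≡ c₀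
            lemma = solve-∀
            s′ u′ v′ c₀′ c₁′ : Polynomial 5
            s′ = var 2F
            u′ = s′ :+ var 3F
            v′ = s′ :* s′ :+ var 3F :* s′ :+ var 4F
            c₀′ = var 0F :* var 0F :+ u′ :* var 0F :+ v′ :- v′ :* (var 1F :* var 1F)
            c₁′ = var 1F :* (con (+ 2) :* var 0F :- u′ :* var 1F :+ u′)
            y m : Carrier
            y = ι P + ι Q * x + ι C * g x
            m = - (ι C * (ι (+ 2) * (ι P + ι Q * x) + ι C * g x + (ι s + ι a)) + ι Q * ι Q)
            coefficients : (+ p ∣ ℤ.- (s ℤ.* c₀)) × (+ p ∣ c₀ ℤ.- s ℤ.* c₁) × (+ p ∣ c₁)
            coefficients = independent-⟦⟧ (:- (s′ :* c₀′)) (c₀′ :- s′ :* c₁′) c₁′ (P ∷ Q ∷ s ∷ a ∷ b ∷ []) (begin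
              _ ≈⟨ solve 7 (λ P Q s a b C x →
                let u = s :+ a
                    v = s :* s :+ a :* s :+ b
                    g = x :* x :+ u :* x :+ v
                    y = P :+ Q :* x :+ C :* g
                    c₁ = Q :* (con (+ 2) :* P :- u :* Q :+ u)
                    c₀ = P :* P :+ u :* P :+ v :- v :* (Q :* Q)
                in (:- (s :* c₀)) :+ (c₀ :- s :* c₁) :* x :+ c₁ :* (x :* x) :=
                   (x :- s) :* (y :* y :+ u :* y :+ v) :+
                   (:- (C :* (con (+ 2) :* (P :+ Q :* x) :+ C :* g :+ u) :+ Q :* Q)) :* ((x :- s) :* g))
                refl (ι P) (ι Q) (ι s) (ι a) (ι b) (ι C) x ⟩
              (x - ι s) * g y + m * ((x - ι s) * g x)
                ≈⟨ +-congʳ (*-congˡ (+-congʳ (+-cong (*-cong y≈ y≈) (*-congˡ y≈)))) ⟩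
              (x - ι s) * g (x ^ p) + m * ((x - ι s) * g x)
                ≈⟨ [x-s]g[x^p]≈0 ⊕ m ⊛ [x-s]g[x]≈0 ⟩
              0# ∎)
              where
              y≈ : y ≈ x ^ p
              y≈ = sym x^p≈

          P≡0∧Q≡1⇒⊥ : + p ∣ P → + p ∣ Q ℤ.- 1ℤ → ⊥
          P≡0∧Q≡1⇒⊥ p∣P p∣Q-1 = x^p≉x (begin
            (x - ι s) * (x ^ p - x)   ≈⟨ *-congˡ (+-congʳ x^p≈) ⟩
            (x - ι s) * (ι P + ι Q * x + ι C * g x - x)
              ≈⟨ solve 6 (λ P Q s C g x →
                (x :- s) :* (P :+ Q :* x :+ C :* g :- x) :=
                (x :- s) :* P :+ (x :- s) :* x :* (Q :- con 1ℤ) :+ C :* ((x :- s) :* g))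
                refl (ι P) (ι Q) (ι s) (ι C) (g x) x ⟩
            (x - ι s) * ι P + (x - ι s) * x * (ι Q - ι 1ℤ) + ι C * ((x - ι s) * g x)
              ≈⟨ ((x - ι s) ⊛ ∣⇒ι≈0 p∣P ⊕ ((x - ι s) * x) ⊛ trans (sym (trans (+-homo _ _) (+-congˡ (-‿homo _)))) (∣⇒ι≈0 p∣Q-1))
                 ⊕ ι C ⊛ [x-s]g[x]≈0 ⟩
            0# ∎)

          reflection : ¬ + p ∣ + 2 → (+ p ∣ P ℤ.+ u) × (+ p ∣ Q ℤ.+ 1ℤ)
          reflection p∤2 = [ (λ d → ⊥-elim (P≡0∧Q≡1⇒⊥ (proj₁ d) (proj₂ d))) , id ]′
            (quadratic-conjugates p-prime p∤2 P Q u v g-rootless (δ-unit p∤2)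
              (proj₁ conjugate-equations) (proj₂ conjugate-equations))

        frobenius-one-root : ¬ + p ∣ + 2 → ∀ {A B C} → x ^ p ≈ ι A + ι B * x + ι C * (x * x) →
          + p ∣ C ℤ.* (+ 3 ℤ.* (s ℤ.* s) ℤ.+ + 2 ℤ.* (a ℤ.* s) ℤ.+ b) ℤ.- (+ 3 ℤ.* s ℤ.+ a)
        frobenius-one-root p∤2 {A} {B} {C} x^p≈ = ≡.subst (+ p ∣_) (lemma A B C s a b)
          (∣m∣n⇒∣m-n (frobenius-at-root {A} {B} {C} x^p≈ s p∣Fs)
            (∣m∣n⇒∣m+n (proj₁ e) (∣m⇒∣m*n s (proj₂ e))))
          where
          lemma : ∀ A B C s a b →
            (A ℤ.+ B ℤ.* s ℤ.+ C ℤ.* (s ℤ.* s) ℤ.- s) ℤ.-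
            ((A ℤ.- C ℤ.* (s ℤ.* s ℤ.+ a ℤ.* s ℤ.+ b) ℤ.+ (s ℤ.+ a)) ℤ.+
             (B ℤ.- C ℤ.* (s ℤ.+ a) ℤ.+ 1ℤ) ℤ.* s) ≡
            C ℤ.* (+ 3 ℤ.* (s ℤ.* s) ℤ.+ + 2 ℤ.* (a ℤ.* s) ℤ.+ b) ℤ.- (+ 3 ℤ.* s ℤ.+ a)
          lemma = solve-∀
          ρ = A ∷ B ∷ C ∷ s ∷ a ∷ b ∷ []
          ι-P = ι-⟦⟧ (var 0F :- var 2F :* (var 3F :* var 3F :+ var 4F :* var 3F :+ var 5F)) ρ
          ι-Q = ι-⟦⟧ (var 1F :- var 2F :* (var 3F :+ var 4F)) ρ
          P = A ℤ.- C ℤ.* (s ℤ.* s ℤ.+ a ℤ.* s ℤ.+ b)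
          Q = B ℤ.- C ℤ.* (s ℤ.+ a)
          reduced : x ^ p ≈ ι (A ℤ.- C ℤ.* (s ℤ.* s ℤ.+ a ℤ.* s ℤ.+ b)) + ι (B ℤ.- C ℤ.* (s ℤ.+ a)) * x + ι C * g x
          reduced = trans x^p≈ (trans (solve 7 (λ A B C s a b x →
              let u = s :+ a
                  v = s :* s :+ a :* s :+ b
              in A :+ B :* x :+ C :* (x :* x) :=
              (A :- C :* v) :+ (B :- C :* u) :* x :+ C :* (x :* x :+ u :* x :+ v))
              refl (ι A) (ι B) (ι C) (ι s) (ι a) (ι b) x) (+-congʳ (+-cong (sym ι-P) (*-congʳ (sym ι-Q)))))
          e = reflection {P} {Q} {C} reduced p∤2

    1≉0 : ¬ 1# ≈ 0#
    1≉0 1≈0 = <p⇒∤ p-prime ℕ.z<s (1<p p-prime) (proj₁ (independent-⟦⟧ (con 1ℤ) (con 0ℤ) (con 0ℤ) [] (begin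
      _           ≈⟨ solve 1 (λ x → con 1ℤ :+ con 0ℤ :* x :+ con 0ℤ :* (x :* x) := con 1ℤ) refl x ⟩
      ι 1ℤ        ≈⟨ 1-homo ⟩
      1#          ≈⟨ 1≈0 ⟩
      0#          ∎)))

    frobenius-quadratic : ∀ A B C t →
      (ι A + ι B * t + ι C * (t * t)) ^ p ≈ ι A + ι B * t ^ p + ι C * (t ^ p * t ^ p)
    frobenius-quadratic A B C t = trans (frobenius-+ _ _) (+-cong
      (trans (frobenius-+ _ _) (+-cong (frobenius-ι A)
        (trans (^-distrib-* _ _ p) (*-congʳ (frobenius-ι B)))))
      (trans (^-distrib-* _ _ p) (*-cong (frobenius-ι C) (^-distrib-* _ _ p))))

    frobenius-f : ∀ t → f t ^ p ≈ f (t ^ p)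
    frobenius-f t = trans (frobenius-+ _ _) (+-cong
      (trans (frobenius-+ _ _) (+-cong
        (trans (frobenius-+ _ _) (+-cong
          (trans (^-distrib-* _ _ p) (*-congʳ (^-distrib-* _ _ p)))
          (trans (^-distrib-* _ _ p) (*-cong (frobenius-ι a) (^-distrib-* _ _ p)))))
        (trans (^-distrib-* _ _ p) (*-congʳ (frobenius-ι b)))))
      (frobenius-ι c))

    f≈0⇒f[^p]≈0 : ∀ {t} → f t ≈ 0# → f (t ^ p) ≈ 0#
    f≈0⇒f[^p]≈0 {t} ft≈0 = trans (sym (frobenius-f t)) (trans (^-congˡ p ft≈0) 0^p≈0)

    module _ (rootless : ∀ t → ¬ + p ∣ F t)
      (coordinates : ∀ w → ∃[ A ] ∃[ B ] ∃[ C ] w ≈ ι A + ι B * x + ι C * (x * x)) where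

      linear-cancel : ∀ A B → ¬ ((+ p ∣ A) × (+ p ∣ B)) → ∀ w → (ι A + ι B * x) * w ≈ 0# → w ≈ 0#
      linear-cancel A B ≢0 w eq with + p ∣? B
      ... | yes p∣B = ι-cancel (λ p∣A → ≢0 (p∣A , p∣B)) w (begin
        ι A * w                          ≈⟨ solve 4 (λ A B x w →
          A :* w := (A :+ B :* x) :* w :+ (:- (x :* w)) :* B) refl (ι A) (ι B) x w ⟩
        (ι A + ι B * x) * w + - (x * w) * ι B   ≈⟨ eq ⊕ - (x * w) ⊛ ∣⇒ι≈0 p∣B ⟩
        0#                               ∎)
      ... | no p∤B with j , inv ← inverse-mod p-prime B p∤B =
        x-s-cancel (ℤ.- (j ℤ.* A)) (rootless (ℤ.- (j ℤ.* A))) w (begin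
          (x - ι (ℤ.- (j ℤ.* A))) * w     ≈⟨ *-congʳ (+-congˡ (-‿cong (trans (-‿homo _) (-‿cong (*-homo j A))))) ⟩
          (x - - (ι j * ι A)) * w         ≈⟨ solve 5 (λ x j A B w →
            (x :- (:- (j :* A))) :* w := j :* ((A :+ B :* x) :* w) :+ (:- (x :* w)) :* (j :* B :- con 1ℤ))
            refl x (ι j) (ι A) (ι B) w ⟩
          ι j * ((ι A + ι B * x) * w) + - (x * w) * (ι j * ι B - ι 1ℤ)
            ≈⟨ ι j ⊛ eq ⊕ - (x * w) ⊛ x≈y⇒x-y≈0 (trans (sym (*-homo j B)) (ι-cong inv)) ⟩
          0#                              ∎)

      -- Division of f by x² + B x + A leaves a linear remainder with the
      -- same annihilated w.
      quadratic-cancel : ∀ A B w → (ι A + ι B * x + x * x) * w ≈ 0# → w ≈ 0#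
      quadratic-cancel A B w eq = linear-cancel r₀ r₁ r≢0 w (begin
        (ι r₀ + ι r₁ * x) * w      ≈⟨ *-congʳ (+-cong
          (ι-⟦⟧ (var 4F :- (var 2F :- var 1F) :* var 0F) ρ)
          (*-congʳ (ι-⟦⟧ (var 3F :- var 0F :- (var 2F :- var 1F) :* var 1F) ρ))) ⟩
        _                          ≈⟨ solve 7 (λ A B a b c x w →
          (c :- (a :- B) :* A :+ (b :- A :- (a :- B) :* B) :* x) :* w :=
          w :* (x :* x :* x :+ a :* (x :* x) :+ b :* x :+ c) :+
          (:- (x :+ (a :- B))) :* ((A :+ B :* x :+ x :* x) :* w))
          refl (ι A) (ι B) (ι a) (ι b) (ι c) x w ⟩
        w * f x + - (x + (ι a - ι B)) * ((ι A + ι B * x + x * x) * w)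
          ≈⟨ w ⊛ x-root ⊕ - (x + (ι a - ι B)) ⊛ eq ⟩
        0#                         ∎)
        where
        ρ = A ∷ B ∷ a ∷ b ∷ c ∷ []
        r₀ r₁ : ℤ
        r₀ = c ℤ.- (a ℤ.- B) ℤ.* A
        r₁ = b ℤ.- A ℤ.- (a ℤ.- B) ℤ.* B
        lemma : ∀ A B a b c → let e = a ℤ.- B ; t = ℤ.- e in
          (c ℤ.- e ℤ.* A) ℤ.- e ℤ.* (b ℤ.- A ℤ.- e ℤ.* B) ≡
          t ℤ.* t ℤ.* t ℤ.+ a ℤ.* (t ℤ.* t) ℤ.+ b ℤ.* t ℤ.+ c
        lemma = solve-∀
        r≢0 : ¬ ((+ p ∣ r₀) × (+ p ∣ r₁))
        r≢0 (p∣r₀ , p∣r₁) = rootless (ℤ.- (a ℤ.- B)) (≡.subst (+ p ∣_) (lemma A B a b c)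
          (∣m∣n⇒∣m-n p∣r₀ (∣n⇒∣m*n (a ℤ.- B) p∣r₁)))

      quadratic-polynomial-cancel : ∀ A B C → ¬ ((+ p ∣ A) × (+ p ∣ B) × (+ p ∣ C)) →
        ∀ w → (ι A + ι B * x + ι C * (x * x)) * w ≈ 0# → w ≈ 0#
      quadratic-polynomial-cancel A B C ≢0 w eq with + p ∣? C
      ... | yes p∣C = linear-cancel A B (λ (p∣A , p∣B) → ≢0 (p∣A , p∣B , p∣C)) w (begin
        (ι A + ι B * x) * w    ≈⟨ solve 5 (λ A B C x w → (A :+ B :* x) :* w :=
          (A :+ B :* x :+ C :* (x :* x)) :* w :+ (:- (x :* x :* w)) :* C) refl (ι A) (ι B) (ι C) x w ⟩
        (ι A + ι B * x + ι C * (x * x)) * w + - (x * x * w) * ι C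
          ≈⟨ eq ⊕ - (x * x * w) ⊛ ∣⇒ι≈0 p∣C ⟩
        0#                     ∎)
      ... | no p∤C with j , inv ← inverse-mod p-prime C p∤C =
        quadratic-cancel (j ℤ.* A) (j ℤ.* B) w (begin
          (ι (j ℤ.* A) + ι (j ℤ.* B) * x + x * x) * w
            ≈⟨ *-congʳ (+-congʳ (+-cong (*-homo j A) (*-congʳ (*-homo j B)))) ⟩
          (ι j * ι A + ι j * ι B * x + x * x) * w
            ≈⟨ solve 6 (λ j A B C x w → (j :* A :+ j :* B :* x :+ x :* x) :* w :=
              j :* ((A :+ B :* x :+ C :* (x :* x)) :* w) :+ (:- (x :* x :* w)) :* (j :* C :- con 1ℤ))
              refl (ι j) (ι A) (ι B) (ι C) x w ⟩
          ι j * ((ι A + ι B * x + ι C * (x * x)) * w) + - (x * x * w) * (ι j * ι C - ι 1ℤ)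
            ≈⟨ ι j ⊛ eq ⊕ - (x * x * w) ⊛ x≈y⇒x-y≈0 (trans (sym (*-homo j C)) (ι-cong inv)) ⟩
          0# ∎)

      zero-product : ∀ v w → v * w ≈ 0# → v ≈ 0# ⊎ w ≈ 0#
      zero-product v w vw≈0 with A , B , C , v≈ ← coordinates v
        with + p ∣? A ×-dec + p ∣? B ×-dec + p ∣? C
      ... | no ≢0 = inj₂ (quadratic-polynomial-cancel A B C ≢0 w (trans (*-congʳ (sym v≈)) vw≈0))
      ... | yes (p∣A , p∣B , p∣C) = inj₁ (trans v≈
        ((∣⇒ι≈0 p∣A ⊕ trans (*-comm _ _) (x ⊛ ∣⇒ι≈0 p∣B)) ⊕ trans (*-comm _ _) ((x * x) ⊛ ∣⇒ι≈0 p∣C)))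

      ^-nilpotent : ∀ n {w} → w ^ n ≈ 0# → w ≈ 0#
      ^-nilpotent zero    1≈0 = ⊥-elim (1≉0 1≈0)
      ^-nilpotent (suc n) eq = [ id , ^-nilpotent n ]′ (zero-product _ _ eq)

      ^p-injective : ∀ {v w} → v ^ p ≈ w ^ p → v ≈ w
      ^p-injective {v} {w} eq = x-y≈0⇒x≈y v w (^-nilpotent p (begin
        (v - w) ^ p                     ≈⟨ solve 2 (λ u t → u := (u :+ t) :- t) refl ((v - w) ^ p) (w ^ p) ⟩
        (v - w) ^ p + w ^ p - w ^ p     ≈⟨ +-congʳ (frobenius-+ (v - w) w) ⟨
        (v - w + w) ^ p - w ^ p         ≈⟨ +-congʳ (^-congˡ p (solve 2 (λ v w → (v :- w) :+ w := v) refl v w)) ⟩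
        v ^ p - w ^ p                   ≈⟨ x≈y⇒x-y≈0 eq ⟩
        0#                              ∎))

      root-not-fixed : ∀ {t} → f t ≈ 0# → ¬ t ^ p ≈ t
      root-not-fixed {t} ft≈0 fixed = 1≉0 (fermat-elim t (_≈ 0#) (λ v≈w → trans (sym v≈w)) divide (x≈y⇒x-y≈0 fixed))
        where
        f-cong : ∀ {s t} → s ≈ t → f s ≈ f t
        f-cong e = +-congʳ (+-cong (+-cong (*-cong (*-cong e e) e) (*-congˡ (*-cong e e))) (*-congˡ e))
        divide : ∀ {i} → i < p → ∀ w → (t - ι (+ i)) * w ≈ 0# → w ≈ 0#
        divide {i} _ w eq = [ (λ t-i≈0 → ⊥-elim (rootless (+ i) (∣F i t-i≈0))) , id ]′ (zero-product _ w eq)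
          where
          ∣F : ∀ i → t - ι (+ i) ≈ 0# → + p ∣ F (+ i)
          ∣F i t-i≈0 = proj₁ (independent (F (+ i)) 0ℤ 0ℤ (begin
            ι (F (+ i)) + ι 0ℤ * x + ι 0ℤ * (x * x)   ≈⟨ solve 2 (λ u x → u :+ con 0ℤ :* x :+ con 0ℤ :* (x :* x) := u) refl _ x ⟩
            ι (F (+ i))     ≈⟨ ι-F (+ i) ⟩
            f (ι (+ i))     ≈⟨ f-cong (x-y≈0⇒x≈y t (ι (+ i)) t-i≈0) ⟨
            f t             ≈⟨ ft≈0 ⟩
            0#              ∎))

      module _ {A B C : ℤ} (x^p≈ : x ^ p ≈ ι A + ι B * x + ι C * (x * x)) where

        private
          y z : Carrier
          y = x ^ p
          z = - ι a - x - y

          h : Carrier → Carrier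
          h t = ι A + ι B * t + ι C * (t * t)

        second-root : y * y + (x + ι a) * y + (x * x + ι a * x + ι b) ≈ 0#
        second-root = [ (λ y-x≈0 → ⊥-elim (root-not-fixed x-root (x-y≈0⇒x≈y y x y-x≈0))) , id ]′
          (zero-product (y - x) _ (begin
            (y - x) * (y * y + (x + ι a) * y + (x * x + ι a * x + ι b))
              ≈⟨ solve 5 (λ x y a b c →
                (y :- x) :* (y :* y :+ (x :+ a) :* y :+ (x :* x :+ a :* x :+ b)) :=
                (y :* y :* y :+ a :* (y :* y) :+ b :* y :+ c) :-
                (x :* x :* x :+ a :* (x :* x) :+ b :* x :+ c)) refl x y (ι a) (ι b) (ι c) ⟩
            f y - f x    ≈⟨ x≈y⇒x-y≈0 (trans (f≈0⇒f[^p]≈0 x-root) (sym x-root)) ⟩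
            0#           ∎))

        f-splits : ∀ t → f t ≈ (t - x) * ((t - y) * (t - z))
        f-splits t = begin
          f t ≈⟨ solve 6 (λ x y a b c t →
            (t :* t :* t :+ a :* (t :* t) :+ b :* t :+ c) :=
            (t :- x) :* ((t :- y) :* (t :- ((:- a) :- x :- y))) :+
            ((x :* x :* x :+ a :* (x :* x) :+ b :* x :+ c) :+
            (t :- x) :* (y :* y :+ (x :+ a) :* y :+ (x :* x :+ a :* x :+ b))))
            refl x y (ι a) (ι b) (ι c) t ⟩
          (t - x) * ((t - y) * (t - z)) + (f x + (t - x) * (y * y + (x + ι a) * y + (x * x + ι a * x + ι b)))
            ≈⟨ +-congˡ (x-root ⊕ (t - x) ⊛ second-root) ⟩
          (t - x) * ((t - y) * (t - z)) + 0#   ≈⟨ +-identityʳ _ ⟩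
          (t - x) * ((t - y) * (t - z))        ∎

        z^p≈ : z ^ p ≈ - ι a - y - y ^ p
        z^p≈ = begin
          z ^ p                      ≈⟨ solve 3 (λ u v w → u := (u :+ (v :+ w)) :- v :- w) refl (z ^ p) (x ^ p) (y ^ p) ⟩
          (z ^ p + (x ^ p + y ^ p)) - x ^ p - y ^ p
            ≈⟨ +-congʳ (+-congʳ (begin
               z ^ p + (x ^ p + y ^ p)   ≈⟨ +-congˡ (frobenius-+ x y) ⟨
               z ^ p + (x + y) ^ p       ≈⟨ frobenius-+ z (x + y) ⟨
               (z + (x + y)) ^ p         ≈⟨ ^-congˡ p (solve 3 (λ x y a → ((:- a) :- x :- y) :+ (x :+ y) := :- a) refl x y (ι a)) ⟩
               (- ι a) ^ p               ≈⟨ ^-congˡ p (-‿homo a) ⟨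
               ι (ℤ.- a) ^ p             ≈⟨ frobenius-ι (ℤ.- a) ⟩
               ι (ℤ.- a)                 ≈⟨ -‿homo a ⟩
               - ι a                     ∎)) ⟩
          - ι a - y - y ^ p          ∎

        y^p≈z : y ^ p ≈ z
        y^p≈z = [ y^p≈x⇒ , [ y^p≈y⇒ , x-y≈0⇒x≈y (y ^ p) z ]′ ∘ zero-product _ _ ]′
          (zero-product _ _ (trans (sym (f-splits (y ^ p))) (f≈0⇒f[^p]≈0 (f≈0⇒f[^p]≈0 x-root))))
          where
          y^p≈y⇒ : y ^ p - y ≈ 0# → y ^ p ≈ z
          y^p≈y⇒ eq = ⊥-elim (root-not-fixed x-root (^p-injective (x-y≈0⇒x≈y (y ^ p) y eq)))
          y^p≈x⇒ : y ^ p - x ≈ 0# → y ^ p ≈ z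
          y^p≈x⇒ eq = ⊥-elim (root-not-fixed
            (trans (f-splits z) (_ ⊛ (_ ⊛ -‿inverseʳ z)))
            (begin
            z ^ p                ≈⟨ z^p≈ ⟩
            - ι a - y - y ^ p    ≈⟨ +-congˡ (-‿cong (x-y≈0⇒x≈y (y ^ p) x eq)) ⟩
            - ι a - y - x        ≈⟨ solve 3 (λ a x y → (:- a) :- y :- x := (:- a) :- x :- y) refl (ι a) x y ⟩
            z                    ∎))

        z≈h[y] : z ≈ h y
        z≈h[y] = trans (sym y^p≈z) (trans (^-congˡ p x^p≈) (frobenius-quadratic A B C x))

        h-cong : ∀ {s t} → s ≈ t → h s ≈ h t
        h-cong e = +-cong (+-congˡ (*-congˡ e)) (*-congˡ (*-cong e e))

        x≈h[z] : x ≈ h z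
        x≈h[z] = begin
          x                        ≈⟨ solve 3 (λ a x y → x := (:- a) :- y :- ((:- a) :- x :- y)) refl (ι a) x y ⟩
          - ι a - y - z            ≈⟨ +-congˡ (-‿cong y^p≈z) ⟨
          - ι a - y - y ^ p        ≈⟨ z^p≈ ⟨
          z ^ p                    ≈⟨ ^-congˡ p z≈h[y] ⟩
          h y ^ p                  ≈⟨ frobenius-quadratic A B C y ⟩
          h (y ^ p)                ≈⟨ h-cong y^p≈z ⟩
          h z                      ∎

        private
          V W : Carrier
          V = (x - y) * ((y - z) * (x - z))
          W = (y - z) * (y - z) - (z - x) * (x - y)

        CV≈W : ι C * V ≈ W
        CV≈W = begin
          ι C * V       ≈⟨ solve 6 (λ A B C x y z →
            let h = λ t → A :+ B :* t :+ C :* (t :* t) in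
            C :* ((x :- y) :* ((y :- z) :* (x :- z))) :=
            (y :- z) :* (h x :- h y) :- (h y :- h z) :* (x :- y))
            refl (ι A) (ι B) (ι C) x y z ⟩
          (y - z) * (h x - h y) - (h y - h z) * (x - y)
            ≈⟨ +-cong (*-congˡ (+-cong (sym x^p≈) (-‿cong (sym z≈h[y]))))
               (-‿cong (*-congʳ (+-cong (sym z≈h[y]) (-‿cong (sym x≈h[z]))))) ⟩
          W             ∎

        frobenius-no-roots :
          + p ∣ discriminant a b c ℤ.* (C ℤ.* C) ℤ.- (a ℤ.* a ℤ.- + 3 ℤ.* b) ℤ.* (a ℤ.* a ℤ.- + 3 ℤ.* b)
        frobenius-no-roots = proj₁ (independent-⟦⟧ E (con 0ℤ) (con 0ℤ) (a ∷ b ∷ c ∷ C ∷ []) (begin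
          ⟦ E ⟧ (ι a ∷ ι b ∷ ι c ∷ ι C ∷ []) + ι 0ℤ * x + ι 0ℤ * (x * x)
            ≈⟨ solve 2 (λ u x → u :+ con 0ℤ :* x :+ con 0ℤ :* (x :* x) := u) refl _ x ⟩
          ⟦ E ⟧ (ι a ∷ ι b ∷ ι c ∷ ι C ∷ [])
            ≈⟨ ⟦⟧-cong E (ι a ∷ ι b ∷ ι c ∷ ι C ∷ [])
                 (- (x + y + z) ∷ x * y + y * z + z * x ∷ - (x * y * z) ∷ ι C ∷ [])
                 (λ { 0F → a≈ ; 1F → b≈ ; 2F → c≈ ; 3F → refl }) ⟩
          ⟦ E ⟧ (- (x + y + z) ∷ x * y + y * z + z * x ∷ - (x * y * z) ∷ ι C ∷ [])
            ≈⟨ solve 4 (λ x y z C →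
              E-expr (:- (x :+ y :+ z)) (x :* y :+ y :* z :+ z :* x) (:- (x :* y :* z)) C :=
              (C :* ((x :- y) :* ((y :- z) :* (x :- z))) :+ ((y :- z) :* (y :- z) :- (z :- x) :* (x :- y))) :*
              (C :* ((x :- y) :* ((y :- z) :* (x :- z))) :- ((y :- z) :* (y :- z) :- (z :- x) :* (x :- y))))
              refl x y z (ι C) ⟩
          (ι C * V + W) * (ι C * V - W)
            ≈⟨ (ι C * V + W) ⊛ x≈y⇒x-y≈0 CV≈W ⟩
          0# ∎))
          where
          E-expr : ∀ {n} → Polynomial n → Polynomial n → Polynomial n → Polynomial n → Polynomial n
          E-expr a b c C =
            (a :* a :* (b :* b) :- con (+ 4) :* (b :* b :* b) :- con (+ 4) :* (a :* a :* a :* c)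
              :+ con (+ 18) :* (a :* b :* c) :- con (+ 27) :* (c :* c)) :* (C :* C) :-
            (a :* a :- con (+ 3) :* b) :* (a :* a :- con (+ 3) :* b)
          E : Polynomial 4
          E = E-expr (var 0F) (var 1F) (var 2F) (var 3F)
          a≈ : ι a ≈ - (x + y + z)
          a≈ = solve 3 (λ x y a → a := :- (x :+ y :+ ((:- a) :- x :- y))) refl x y (ι a)
          b≈ : ι b ≈ x * y + y * z + z * x
          b≈ = begin
            ι b   ≈⟨ solve 4 (λ x y a b → let z = (:- a) :- x :- y in
              b := (x :* y :+ y :* z :+ z :* x) :+ (y :* y :+ (x :+ a) :* y :+ (x :* x :+ a :* x :+ b)))
              refl x y (ι a) (ι b) ⟩
            (x * y + y * z + z * x) + (y * y + (x + ι a) * y + (x * x + ι a * x + ι b))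
                  ≈⟨ trans (+-congˡ second-root) (+-identityʳ _) ⟩
            x * y + y * z + z * x ∎
          c≈ : ι c ≈ - (x * y * z)
          c≈ = begin
            ι c       ≈⟨ solve 3 (λ a b c →
              c := con 0ℤ :* con 0ℤ :* con 0ℤ :+ a :* (con 0ℤ :* con 0ℤ) :+ b :* con 0ℤ :+ c)
              refl (ι a) (ι b) (ι c) ⟩
            f (ι 0ℤ)  ≈⟨ f-splits (ι 0ℤ) ⟩
            (ι 0ℤ - x) * ((ι 0ℤ - y) * (ι 0ℤ - z))
                    ≈⟨ solve 3 (λ x y z →
                      (con 0ℤ :- x) :* ((con 0ℤ :- y) :* (con 0ℤ :- z)) := :- (x :* y :* z)) refl x y z ⟩
            - (x * y * z) ∎

-- The ring 𝔽_p[x]/(x³ + a x² + b x + c)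

record Residue : Set where
  constructor ⟨_,_,_⟩
  field c₀ c₁ c₂ : ℤ
open Residue

module ResidueRing (p : ℕ) (a b c : ℤ) where

  -- The wrapper lets Agda infer the two sides, which it cannot do from the
  -- unfolded divisibility statement.
  infix 4 _∼_
  record _∼_ (i j : ℤ) : Set where
    constructor wrap
    field unwrap : i ≡ j [mod p ]
  open _∼_ public

  infix 4 _≈_
  record _≈_ (u v : Residue) : Set where
    constructor ⟪_,_,_⟫
    field
      eq₀ : c₀ u ∼ c₀ v
      eq₁ : c₁ u ∼ c₁ v
      eq₂ : c₂ u ∼ c₂ v

  ∼-reflexive : ∀ {i j} → i ≡ j → i ∼ j
  ∼-reflexive e = wrap (mod-reflexive e)

  ∼-refl : ∀ i → i ∼ i
  ∼-refl i = ∼-reflexive ≡.refl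

  ∼-sym : ∀ {i j} → i ∼ j → j ∼ i
  ∼-sym {i} {j} (wrap d) = wrap (mod-sym {p} {i} {j} d)

  ∼-trans : ∀ {i j k} → i ∼ j → j ∼ k → i ∼ k
  ∼-trans {i} {j} {k} (wrap d) (wrap e) = wrap (mod-trans {p} {i} {j} {k} d e)

  infixl 6 _+∼_
  infixl 7 _*∼_
  infix  8 -∼_

  _+∼_ : ∀ {i j k l} → i ∼ j → k ∼ l → i ℤ.+ k ∼ j ℤ.+ l
  _+∼_ {i} {j} {k} {l} (wrap d) (wrap e) = wrap (+-mod {p} {i} {j} {k} {l} d e)

  _*∼_ : ∀ {i j k l} → i ∼ j → k ∼ l → i ℤ.* k ∼ j ℤ.* l
  _*∼_ {i} {j} {k} {l} (wrap d) (wrap e) = wrap (*-mod {p} {i} {j} {k} {l} d e)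

  -∼_ : ∀ {i j} → i ∼ j → ℤ.- i ∼ ℤ.- j
  -∼_ {i} {j} (wrap d) = wrap (neg-mod {p} {i} {j} d)

  infixl 6 _+_

  _+_ : Residue → Residue → Residue
  u + v = ⟨ c₀ u ℤ.+ c₀ v , c₁ u ℤ.+ c₁ v , c₂ u ℤ.+ c₂ v ⟩

  -_ : Residue → Residue
  - u = ⟨ ℤ.- c₀ u , ℤ.- c₁ u , ℤ.- c₂ u ⟩

  constant : ℤ → Residue
  constant n = ⟨ n , 0ℤ , 0ℤ ⟩

  x : Residue
  x = ⟨ 0ℤ , 1ℤ , 0ℤ ⟩

  exact : ∀ {u v} → c₀ u ≡ c₀ v → c₁ u ≡ c₁ v → c₂ u ≡ c₂ v → u ≈ v
  exact e₀ e₁ e₂ = ⟪ ∼-reflexive e₀ , ∼-reflexive e₁ , ∼-reflexive e₂ ⟫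

  +-cong : ∀ {t u v w} → t ≈ u → v ≈ w → t + v ≈ u + w
  +-cong ⟪ d₀ , d₁ , d₂ ⟫ ⟪ e₀ , e₁ , e₂ ⟫ = ⟪ d₀ +∼ e₀ , d₁ +∼ e₁ , d₂ +∼ e₂ ⟫

  infixl 7 _*_
  shift : Residue → Residue
  shift ⟨ q₀ , q₁ , q₂ ⟩ = ⟨ ℤ.- (c ℤ.* q₂) , q₀ ℤ.- b ℤ.* q₂ , q₁ ℤ.- a ℤ.* q₂ ⟩

  abstract
    -- reduction by x³ = -(a x² + b x + c) and
    -- x⁴ = (a² - b) x² + (a b - c) x + a c
    _*_ : Residue → Residue → Residue
    ⟨ u₀ , u₁ , u₂ ⟩ * ⟨ v₀ , v₁ , v₂ ⟩ =
      ⟨ u₀ ℤ.* v₀ ℤ.- c ℤ.* (u₁ ℤ.* v₂ ℤ.+ u₂ ℤ.* v₁) ℤ.+ a ℤ.* c ℤ.* (u₂ ℤ.* v₂)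
      , u₀ ℤ.* v₁ ℤ.+ u₁ ℤ.* v₀ ℤ.- b ℤ.* (u₁ ℤ.* v₂ ℤ.+ u₂ ℤ.* v₁) ℤ.+ (a ℤ.* b ℤ.- c) ℤ.* (u₂ ℤ.* v₂)
      , u₀ ℤ.* v₂ ℤ.+ u₁ ℤ.* v₁ ℤ.+ u₂ ℤ.* v₀ ℤ.- a ℤ.* (u₁ ℤ.* v₂ ℤ.+ u₂ ℤ.* v₁) ℤ.+ (a ℤ.* a ℤ.- b) ℤ.* (u₂ ℤ.* v₂)
      ⟩

    *-cong : ∀ {t u v w} → t ≈ u → v ≈ w → t * v ≈ u * w
    *-cong ⟪ d₀ , d₁ , d₂ ⟫ ⟪ e₀ , e₁ , e₂ ⟫ =
      ⟪ d₀ *∼ e₀ +∼ -∼ (∼-refl c *∼ (d₁ *∼ e₂ +∼ d₂ *∼ e₁)) +∼ ∼-refl (a ℤ.* c) *∼ (d₂ *∼ e₂)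
      , d₀ *∼ e₁ +∼ d₁ *∼ e₀ +∼ -∼ (∼-refl b *∼ (d₁ *∼ e₂ +∼ d₂ *∼ e₁)) +∼ ∼-refl (a ℤ.* b ℤ.- c) *∼ (d₂ *∼ e₂)
      , d₀ *∼ e₂ +∼ d₁ *∼ e₁ +∼ d₂ *∼ e₀ +∼ -∼ (∼-refl a *∼ (d₁ *∼ e₂ +∼ d₂ *∼ e₁)) +∼ ∼-refl (a ℤ.* a ℤ.- b) *∼ (d₂ *∼ e₂)
      ⟫

    *-assoc : ∀ u v w → (u * v) * w ≈ u * (v * w)
    *-assoc ⟨ u₀ , u₁ , u₂ ⟩ ⟨ v₀ , v₁ , v₂ ⟩ ⟨ w₀ , w₁ , w₂ ⟩ = exact
      (assoc₀ a b c u₀ u₁ u₂ v₀ v₁ v₂ w₀ w₁ w₂)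
      (assoc₁ a b c u₀ u₁ u₂ v₀ v₁ v₂ w₀ w₁ w₂)
      (assoc₂ a b c u₀ u₁ u₂ v₀ v₁ v₂ w₀ w₁ w₂)
      where
      assoc₀ : (a b c u₀ u₁ u₂ v₀ v₁ v₂ w₀ w₁ w₂ : ℤ) →
        let y₃ = u₁ ℤ.* v₂ ℤ.+ u₂ ℤ.* v₁ ; y₄ = u₂ ℤ.* v₂
            y₀ = u₀ ℤ.* v₀ ℤ.- c ℤ.* y₃ ℤ.+ a ℤ.* c ℤ.* y₄
            y₁ = u₀ ℤ.* v₁ ℤ.+ u₁ ℤ.* v₀ ℤ.- b ℤ.* y₃ ℤ.+ (a ℤ.* b ℤ.- c) ℤ.* y₄
            y₂ = u₀ ℤ.* v₂ ℤ.+ u₁ ℤ.* v₁ ℤ.+ u₂ ℤ.* v₀ ℤ.- a ℤ.* y₃ ℤ.+ (a ℤ.* a ℤ.- b) ℤ.* y₄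
            z₃ = v₁ ℤ.* w₂ ℤ.+ v₂ ℤ.* w₁ ; z₄ = v₂ ℤ.* w₂
            z₀ = v₀ ℤ.* w₀ ℤ.- c ℤ.* z₃ ℤ.+ a ℤ.* c ℤ.* z₄
            z₁ = v₀ ℤ.* w₁ ℤ.+ v₁ ℤ.* w₀ ℤ.- b ℤ.* z₃ ℤ.+ (a ℤ.* b ℤ.- c) ℤ.* z₄
            z₂ = v₀ ℤ.* w₂ ℤ.+ v₁ ℤ.* w₁ ℤ.+ v₂ ℤ.* w₀ ℤ.- a ℤ.* z₃ ℤ.+ (a ℤ.* a ℤ.- b) ℤ.* z₄
        in y₀ ℤ.* w₀ ℤ.- c ℤ.* (y₁ ℤ.* w₂ ℤ.+ y₂ ℤ.* w₁) ℤ.+ a ℤ.* c ℤ.* (y₂ ℤ.* w₂) ≡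
           u₀ ℤ.* z₀ ℤ.- c ℤ.* (u₁ ℤ.* z₂ ℤ.+ u₂ ℤ.* z₁) ℤ.+ a ℤ.* c ℤ.* (u₂ ℤ.* z₂)
      assoc₀ = solve-∀
      assoc₁ : (a b c u₀ u₁ u₂ v₀ v₁ v₂ w₀ w₁ w₂ : ℤ) →
        let y₃ = u₁ ℤ.* v₂ ℤ.+ u₂ ℤ.* v₁ ; y₄ = u₂ ℤ.* v₂
            y₀ = u₀ ℤ.* v₀ ℤ.- c ℤ.* y₃ ℤ.+ a ℤ.* c ℤ.* y₄
            y₁ = u₀ ℤ.* v₁ ℤ.+ u₁ ℤ.* v₀ ℤ.- b ℤ.* y₃ ℤ.+ (a ℤ.* b ℤ.- c) ℤ.* y₄
            y₂ = u₀ ℤ.* v₂ ℤ.+ u₁ ℤ.* v₁ ℤ.+ u₂ ℤ.* v₀ ℤ.- a ℤ.* y₃ ℤ.+ (a ℤ.* a ℤ.- b) ℤ.* y₄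
            z₃ = v₁ ℤ.* w₂ ℤ.+ v₂ ℤ.* w₁ ; z₄ = v₂ ℤ.* w₂
            z₀ = v₀ ℤ.* w₀ ℤ.- c ℤ.* z₃ ℤ.+ a ℤ.* c ℤ.* z₄
            z₁ = v₀ ℤ.* w₁ ℤ.+ v₁ ℤ.* w₀ ℤ.- b ℤ.* z₃ ℤ.+ (a ℤ.* b ℤ.- c) ℤ.* z₄
            z₂ = v₀ ℤ.* w₂ ℤ.+ v₁ ℤ.* w₁ ℤ.+ v₂ ℤ.* w₀ ℤ.- a ℤ.* z₃ ℤ.+ (a ℤ.* a ℤ.- b) ℤ.* z₄
        in y₀ ℤ.* w₁ ℤ.+ y₁ ℤ.* w₀ ℤ.- b ℤ.* (y₁ ℤ.* w₂ ℤ.+ y₂ ℤ.* w₁) ℤ.+ (a ℤ.* b ℤ.- c) ℤ.* (y₂ ℤ.* w₂) ≡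
           u₀ ℤ.* z₁ ℤ.+ u₁ ℤ.* z₀ ℤ.- b ℤ.* (u₁ ℤ.* z₂ ℤ.+ u₂ ℤ.* z₁) ℤ.+ (a ℤ.* b ℤ.- c) ℤ.* (u₂ ℤ.* z₂)
      assoc₁ = solve-∀
      assoc₂ : (a b c u₀ u₁ u₂ v₀ v₁ v₂ w₀ w₁ w₂ : ℤ) →
        let y₃ = u₁ ℤ.* v₂ ℤ.+ u₂ ℤ.* v₁ ; y₄ = u₂ ℤ.* v₂
            y₀ = u₀ ℤ.* v₀ ℤ.- c ℤ.* y₃ ℤ.+ a ℤ.* c ℤ.* y₄
            y₁ = u₀ ℤ.* v₁ ℤ.+ u₁ ℤ.* v₀ ℤ.- b ℤ.* y₃ ℤ.+ (a ℤ.* b ℤ.- c) ℤ.* y₄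
            y₂ = u₀ ℤ.* v₂ ℤ.+ u₁ ℤ.* v₁ ℤ.+ u₂ ℤ.* v₀ ℤ.- a ℤ.* y₃ ℤ.+ (a ℤ.* a ℤ.- b) ℤ.* y₄
            z₃ = v₁ ℤ.* w₂ ℤ.+ v₂ ℤ.* w₁ ; z₄ = v₂ ℤ.* w₂
            z₀ = v₀ ℤ.* w₀ ℤ.- c ℤ.* z₃ ℤ.+ a ℤ.* c ℤ.* z₄
            z₁ = v₀ ℤ.* w₁ ℤ.+ v₁ ℤ.* w₀ ℤ.- b ℤ.* z₃ ℤ.+ (a ℤ.* b ℤ.- c) ℤ.* z₄
            z₂ = v₀ ℤ.* w₂ ℤ.+ v₁ ℤ.* w₁ ℤ.+ v₂ ℤ.* w₀ ℤ.- a ℤ.* z₃ ℤ.+ (a ℤ.* a ℤ.- b) ℤ.* z₄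
        in y₀ ℤ.* w₂ ℤ.+ y₁ ℤ.* w₁ ℤ.+ y₂ ℤ.* w₀ ℤ.- a ℤ.* (y₁ ℤ.* w₂ ℤ.+ y₂ ℤ.* w₁) ℤ.+ (a ℤ.* a ℤ.- b) ℤ.* (y₂ ℤ.* w₂) ≡
           u₀ ℤ.* z₂ ℤ.+ u₁ ℤ.* z₁ ℤ.+ u₂ ℤ.* z₀ ℤ.- a ℤ.* (u₁ ℤ.* z₂ ℤ.+ u₂ ℤ.* z₁) ℤ.+ (a ℤ.* a ℤ.- b) ℤ.* (u₂ ℤ.* z₂)
      assoc₂ = solve-∀

    *-comm : ∀ u v → u * v ≈ v * u
    *-comm ⟨ u₀ , u₁ , u₂ ⟩ ⟨ v₀ , v₁ , v₂ ⟩ = exact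
      (lemma₀ a b c u₀ u₁ u₂ v₀ v₁ v₂)
      (lemma₁ a b c u₀ u₁ u₂ v₀ v₁ v₂)
      (lemma₂ a b c u₀ u₁ u₂ v₀ v₁ v₂)
      where
      lemma₀ : (a b c u₀ u₁ u₂ v₀ v₁ v₂ : ℤ) →
        u₀ ℤ.* v₀ ℤ.- c ℤ.* (u₁ ℤ.* v₂ ℤ.+ u₂ ℤ.* v₁) ℤ.+ a ℤ.* c ℤ.* (u₂ ℤ.* v₂) ≡
        v₀ ℤ.* u₀ ℤ.- c ℤ.* (v₁ ℤ.* u₂ ℤ.+ v₂ ℤ.* u₁) ℤ.+ a ℤ.* c ℤ.* (v₂ ℤ.* u₂)
      lemma₀ = solve-∀
      lemma₁ : (a b c u₀ u₁ u₂ v₀ v₁ v₂ : ℤ) →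
        u₀ ℤ.* v₁ ℤ.+ u₁ ℤ.* v₀ ℤ.- b ℤ.* (u₁ ℤ.* v₂ ℤ.+ u₂ ℤ.* v₁) ℤ.+ (a ℤ.* b ℤ.- c) ℤ.* (u₂ ℤ.* v₂) ≡
        v₀ ℤ.* u₁ ℤ.+ v₁ ℤ.* u₀ ℤ.- b ℤ.* (v₁ ℤ.* u₂ ℤ.+ v₂ ℤ.* u₁) ℤ.+ (a ℤ.* b ℤ.- c) ℤ.* (v₂ ℤ.* u₂)
      lemma₁ = solve-∀
      lemma₂ : (a b c u₀ u₁ u₂ v₀ v₁ v₂ : ℤ) →
        u₀ ℤ.* v₂ ℤ.+ u₁ ℤ.* v₁ ℤ.+ u₂ ℤ.* v₀ ℤ.- a ℤ.* (u₁ ℤ.* v₂ ℤ.+ u₂ ℤ.* v₁) ℤ.+ (a ℤ.* a ℤ.- b) ℤ.* (u₂ ℤ.* v₂) ≡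
        v₀ ℤ.* u₂ ℤ.+ v₁ ℤ.* u₁ ℤ.+ v₂ ℤ.* u₀ ℤ.- a ℤ.* (v₁ ℤ.* u₂ ℤ.+ v₂ ℤ.* u₁) ℤ.+ (a ℤ.* a ℤ.- b) ℤ.* (v₂ ℤ.* u₂)
      lemma₂ = solve-∀

    distribˡ : ∀ u v w → u * (v + w) ≈ u * v + u * w
    distribˡ ⟨ u₀ , u₁ , u₂ ⟩ ⟨ v₀ , v₁ , v₂ ⟩ ⟨ w₀ , w₁ , w₂ ⟩ = exact
      (lemma₀ a b c u₀ u₁ u₂ v₀ v₁ v₂ w₀ w₁ w₂)
      (lemma₁ a b c u₀ u₁ u₂ v₀ v₁ v₂ w₀ w₁ w₂)
      (lemma₂ a b c u₀ u₁ u₂ v₀ v₁ v₂ w₀ w₁ w₂)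
      where
      lemma₀ : (a b c u₀ u₁ u₂ v₀ v₁ v₂ w₀ w₁ w₂ : ℤ) →
        u₀ ℤ.* (v₀ ℤ.+ w₀) ℤ.- c ℤ.* (u₁ ℤ.* (v₂ ℤ.+ w₂) ℤ.+ u₂ ℤ.* (v₁ ℤ.+ w₁)) ℤ.+ a ℤ.* c ℤ.* (u₂ ℤ.* (v₂ ℤ.+ w₂)) ≡
        (u₀ ℤ.* v₀ ℤ.- c ℤ.* (u₁ ℤ.* v₂ ℤ.+ u₂ ℤ.* v₁) ℤ.+ a ℤ.* c ℤ.* (u₂ ℤ.* v₂)) ℤ.+
        (u₀ ℤ.* w₀ ℤ.- c ℤ.* (u₁ ℤ.* w₂ ℤ.+ u₂ ℤ.* w₁) ℤ.+ a ℤ.* c ℤ.* (u₂ ℤ.* w₂))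
      lemma₀ = solve-∀
      lemma₁ : (a b c u₀ u₁ u₂ v₀ v₁ v₂ w₀ w₁ w₂ : ℤ) →
        u₀ ℤ.* (v₁ ℤ.+ w₁) ℤ.+ u₁ ℤ.* (v₀ ℤ.+ w₀) ℤ.- b ℤ.* (u₁ ℤ.* (v₂ ℤ.+ w₂) ℤ.+ u₂ ℤ.* (v₁ ℤ.+ w₁)) ℤ.+ (a ℤ.* b ℤ.- c) ℤ.* (u₂ ℤ.* (v₂ ℤ.+ w₂)) ≡
        (u₀ ℤ.* v₁ ℤ.+ u₁ ℤ.* v₀ ℤ.- b ℤ.* (u₁ ℤ.* v₂ ℤ.+ u₂ ℤ.* v₁) ℤ.+ (a ℤ.* b ℤ.- c) ℤ.* (u₂ ℤ.* v₂)) ℤ.+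
        (u₀ ℤ.* w₁ ℤ.+ u₁ ℤ.* w₀ ℤ.- b ℤ.* (u₁ ℤ.* w₂ ℤ.+ u₂ ℤ.* w₁) ℤ.+ (a ℤ.* b ℤ.- c) ℤ.* (u₂ ℤ.* w₂))
      lemma₁ = solve-∀
      lemma₂ : (a b c u₀ u₁ u₂ v₀ v₁ v₂ w₀ w₁ w₂ : ℤ) →
        u₀ ℤ.* (v₂ ℤ.+ w₂) ℤ.+ u₁ ℤ.* (v₁ ℤ.+ w₁) ℤ.+ u₂ ℤ.* (v₀ ℤ.+ w₀) ℤ.- a ℤ.* (u₁ ℤ.* (v₂ ℤ.+ w₂) ℤ.+ u₂ ℤ.* (v₁ ℤ.+ w₁)) ℤ.+ (a ℤ.* a ℤ.- b) ℤ.* (u₂ ℤ.* (v₂ ℤ.+ w₂)) ≡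
        (u₀ ℤ.* v₂ ℤ.+ u₁ ℤ.* v₁ ℤ.+ u₂ ℤ.* v₀ ℤ.- a ℤ.* (u₁ ℤ.* v₂ ℤ.+ u₂ ℤ.* v₁) ℤ.+ (a ℤ.* a ℤ.- b) ℤ.* (u₂ ℤ.* v₂)) ℤ.+
        (u₀ ℤ.* w₂ ℤ.+ u₁ ℤ.* w₁ ℤ.+ u₂ ℤ.* w₀ ℤ.- a ℤ.* (u₁ ℤ.* w₂ ℤ.+ u₂ ℤ.* w₁) ℤ.+ (a ℤ.* a ℤ.- b) ℤ.* (u₂ ℤ.* w₂))
      lemma₂ = solve-∀

    *-identityˡ : ∀ u → constant 1ℤ * u ≈ u
    *-identityˡ ⟨ u₀ , u₁ , u₂ ⟩ = exact
      (lemma₀ a b c u₀ u₁ u₂)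
      (lemma₁ a b c u₀ u₁ u₂)
      (lemma₂ a b c u₀ u₁ u₂)
      where
      lemma₀ : (a b c u₀ u₁ u₂ : ℤ) →
        1ℤ ℤ.* u₀ ℤ.- c ℤ.* (0ℤ ℤ.* u₂ ℤ.+ 0ℤ ℤ.* u₁) ℤ.+ a ℤ.* c ℤ.* (0ℤ ℤ.* u₂) ≡
        u₀
      lemma₀ = solve-∀
      lemma₁ : (a b c u₀ u₁ u₂ : ℤ) →
        1ℤ ℤ.* u₁ ℤ.+ 0ℤ ℤ.* u₀ ℤ.- b ℤ.* (0ℤ ℤ.* u₂ ℤ.+ 0ℤ ℤ.* u₁) ℤ.+ (a ℤ.* b ℤ.- c) ℤ.* (0ℤ ℤ.* u₂) ≡
        u₁
      lemma₁ = solve-∀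
      lemma₂ : (a b c u₀ u₁ u₂ : ℤ) →
        1ℤ ℤ.* u₂ ℤ.+ 0ℤ ℤ.* u₁ ℤ.+ 0ℤ ℤ.* u₀ ℤ.- a ℤ.* (0ℤ ℤ.* u₂ ℤ.+ 0ℤ ℤ.* u₁) ℤ.+ (a ℤ.* a ℤ.- b) ℤ.* (0ℤ ℤ.* u₂) ≡
        u₂
      lemma₂ = solve-∀

    constant-* : ∀ k q → constant k * q ≈ ⟨ k ℤ.* c₀ q , k ℤ.* c₁ q , k ℤ.* c₂ q ⟩
    constant-* k ⟨ q₀ , q₁ , q₂ ⟩ = exact (lemma₀ a c k q₀ q₁ q₂) (lemma₁ a b c k q₀ q₁ q₂) (lemma₂ a b k q₀ q₁ q₂)
      where
      lemma₀ : (a c k q₀ q₁ q₂ : ℤ) →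
        k ℤ.* q₀ ℤ.- c ℤ.* (0ℤ ℤ.* q₂ ℤ.+ 0ℤ ℤ.* q₁) ℤ.+ a ℤ.* c ℤ.* (0ℤ ℤ.* q₂) ≡ k ℤ.* q₀
      lemma₀ = solve-∀
      lemma₁ : (a b c k q₀ q₁ q₂ : ℤ) →
        k ℤ.* q₁ ℤ.+ 0ℤ ℤ.* q₀ ℤ.- b ℤ.* (0ℤ ℤ.* q₂ ℤ.+ 0ℤ ℤ.* q₁) ℤ.+ (a ℤ.* b ℤ.- c) ℤ.* (0ℤ ℤ.* q₂) ≡ k ℤ.* q₁
      lemma₁ = solve-∀
      lemma₂ : (a b k q₀ q₁ q₂ : ℤ) →
        k ℤ.* q₂ ℤ.+ 0ℤ ℤ.* q₁ ℤ.+ 0ℤ ℤ.* q₀ ℤ.- a ℤ.* (0ℤ ℤ.* q₂ ℤ.+ 0ℤ ℤ.* q₁) ℤ.+ (a ℤ.* a ℤ.- b) ℤ.* (0ℤ ℤ.* q₂) ≡ k ℤ.* q₂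
      lemma₂ = solve-∀

    x-* : ∀ q → x * q ≈ shift q
    x-* ⟨ q₀ , q₁ , q₂ ⟩ = exact (lemma₀ a c q₀ q₁ q₂) (lemma₁ a b c q₀ q₁ q₂) (lemma₂ a b q₀ q₁ q₂)
      where
      lemma₀ : (a c q₀ q₁ q₂ : ℤ) →
        0ℤ ℤ.* q₀ ℤ.- c ℤ.* (1ℤ ℤ.* q₂ ℤ.+ 0ℤ ℤ.* q₁) ℤ.+ a ℤ.* c ℤ.* (0ℤ ℤ.* q₂) ≡ ℤ.- (c ℤ.* q₂)
      lemma₀ = solve-∀
      lemma₁ : (a b c q₀ q₁ q₂ : ℤ) →
        0ℤ ℤ.* q₁ ℤ.+ 1ℤ ℤ.* q₀ ℤ.- b ℤ.* (1ℤ ℤ.* q₂ ℤ.+ 0ℤ ℤ.* q₁) ℤ.+ (a ℤ.* b ℤ.- c) ℤ.* (0ℤ ℤ.* q₂) ≡ q₀ ℤ.- b ℤ.* q₂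
      lemma₁ = solve-∀
      lemma₂ : (a b q₀ q₁ q₂ : ℤ) →
        0ℤ ℤ.* q₂ ℤ.+ 1ℤ ℤ.* q₁ ℤ.+ 0ℤ ℤ.* q₀ ℤ.- a ℤ.* (1ℤ ℤ.* q₂ ℤ.+ 0ℤ ℤ.* q₁) ℤ.+ (a ℤ.* a ℤ.- b) ℤ.* (0ℤ ℤ.* q₂) ≡ q₁ ℤ.- a ℤ.* q₂
      lemma₂ = solve-∀

  ≈-refl : ∀ {u} → u ≈ u
  ≈-refl = exact ≡.refl ≡.refl ≡.refl

  ≈-sym : ∀ {u v} → u ≈ v → v ≈ u
  ≈-sym ⟪ d₀ , d₁ , d₂ ⟫ = ⟪ ∼-sym d₀ , ∼-sym d₁ , ∼-sym d₂ ⟫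

  ≈-trans : ∀ {u v w} → u ≈ v → v ≈ w → u ≈ w
  ≈-trans ⟪ d₀ , d₁ , d₂ ⟫ ⟪ e₀ , e₁ , e₂ ⟫ = ⟪ ∼-trans d₀ e₀ , ∼-trans d₁ e₁ , ∼-trans d₂ e₂ ⟫

  commutativeRing : CommutativeRing 0ℓ 0ℓ
  commutativeRing = record
    { Carrier = Residue
    ; _≈_ = _≈_
    ; _+_ = _+_
    ; _*_ = _*_
    ; -_ = -_
    ; 0# = constant 0ℤ
    ; 1# = constant 1ℤ
    ; isCommutativeRing = record
      { isRing = record
        { +-isAbelianGroup = record
          { isGroup = record
            { isMonoid = record
              { isSemigroup = record
                { isMagma = record
                  { isEquivalence = record
                    { refl = ≈-refl
                    ; sym = ≈-sym
                    ; trans = ≈-trans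
                    }
                  ; ∙-cong = +-cong
                  }
                ; assoc = λ u v w → exact
                    (ℤ.+-assoc (c₀ u) (c₀ v) (c₀ w)) (ℤ.+-assoc (c₁ u) (c₁ v) (c₁ w)) (ℤ.+-assoc (c₂ u) (c₂ v) (c₂ w))
                }
              ; identity =
                  (λ u → exact (ℤ.+-identityˡ (c₀ u)) (ℤ.+-identityˡ (c₁ u)) (ℤ.+-identityˡ (c₂ u)))
                , (λ u → exact (ℤ.+-identityʳ (c₀ u)) (ℤ.+-identityʳ (c₁ u)) (ℤ.+-identityʳ (c₂ u)))
              }
            ; inverse =
                (λ u → exact (ℤ.+-inverseˡ (c₀ u)) (ℤ.+-inverseˡ (c₁ u)) (ℤ.+-inverseˡ (c₂ u)))
              , (λ u → exact (ℤ.+-inverseʳ (c₀ u)) (ℤ.+-inverseʳ (c₁ u)) (ℤ.+-inverseʳ (c₂ u)))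
            ; ⁻¹-cong = λ { ⟪ d₀ , d₁ , d₂ ⟫ → ⟪ -∼ d₀ , -∼ d₁ , -∼ d₂ ⟫ }
            }
          ; comm = λ u v → exact (ℤ.+-comm (c₀ u) (c₀ v)) (ℤ.+-comm (c₁ u) (c₁ v)) (ℤ.+-comm (c₂ u) (c₂ v))
          }
        ; *-cong = *-cong
        ; *-assoc = *-assoc
        ; *-identity = *-identityˡ , λ u → ≈-trans (*-comm u (constant 1ℤ)) (*-identityˡ u)
        ; distrib = distribˡ , λ u v w → ≈-trans (*-comm (v + w) u)
            (≈-trans (distribˡ u v w) (+-cong (*-comm u v) (*-comm u w)))
        }
      ; *-comm = *-comm
      }
    }

  constant-homomorphism : ℤ.+-*-rawRing -Raw-AlmostCommutative⟶ fromCommutativeRing commutativeRing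
  constant-homomorphism = record
    { ⟦_⟧ = constant
    ; +-homo = λ i j → ≈-refl
    ; *-homo = λ i j → ≈-sym (≈-trans (constant-* i (constant j)) (exact ≡.refl (ℤ.*-zeroʳ i) (ℤ.*-zeroʳ i)))
    ; -‿homo = λ i → ≈-refl
    ; 0-homo = ≈-refl
    ; 1-homo = ≈-refl
    }

  constant-p : constant (+ p) ≈ constant 0ℤ
  constant-p = ⟪ wrap (divides 1ℤ (lemma (+ p))) , ∼-refl 0ℤ , ∼-refl 0ℤ ⟫
    where
    lemma : ∀ i → i ℤ.- 0ℤ ≡ 1ℤ ℤ.* i
    lemma = solve-∀

  basis : ∀ A B C → constant A + constant B * x + constant C * (x * x) ≈ ⟨ A , B , C ⟩
  basis A B C = ≈-trans
    (+-cong (+-cong (≈-refl {constant A}) (constant-* B x))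
      (≈-trans (*-cong (≈-refl {constant C}) (x-* x)) (constant-* C (shift x))))
    (exact (lemma₀ A B C c) (lemma₁ A B C b) (lemma₂ A B C a))
    where
    lemma₀ : ∀ A B C c → A ℤ.+ B ℤ.* 0ℤ ℤ.+ C ℤ.* (ℤ.- (c ℤ.* 0ℤ)) ≡ A
    lemma₀ = solve-∀
    lemma₁ : ∀ A B C b → 0ℤ ℤ.+ B ℤ.* 1ℤ ℤ.+ C ℤ.* (0ℤ ℤ.- b ℤ.* 0ℤ) ≡ B
    lemma₁ = solve-∀
    lemma₂ : ∀ A B C a → 0ℤ ℤ.+ B ℤ.* 0ℤ ℤ.+ C ℤ.* (1ℤ ℤ.- a ℤ.* 0ℤ) ≡ C
    lemma₂ = solve-∀

  independent : ∀ A B C → constant A + constant B * x + constant C * (x * x) ≈ constant 0ℤ →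
    (+ p ∣ A) × (+ p ∣ B) × (+ p ∣ C)
  independent A B C eq =
    ≡0⇒∣ {i = A} (unwrap (_≈_.eq₀ coordinates≈0)) ,
    ≡0⇒∣ {i = B} (unwrap (_≈_.eq₁ coordinates≈0)) ,
    ≡0⇒∣ {i = C} (unwrap (_≈_.eq₂ coordinates≈0))
    where
    coordinates≈0 : ⟨ A , B , C ⟩ ≈ constant 0ℤ
    coordinates≈0 = ≈-trans (≈-sym (basis A B C)) eq

  coordinates : ∀ w → ∃[ A ] ∃[ B ] ∃[ C ] w ≈ constant A + constant B * x + constant C * (x * x)
  coordinates ⟨ A , B , C ⟩ = A , B , C , ≈-sym (basis A B C)

  x-root : x * x * x + constant a * (x * x) + constant b * x + constant c ≈ constant 0ℤ
  x-root = ≈-trans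
    (+-cong (+-cong (+-cong
      (≈-trans (*-comm (x * x) x) (≈-trans (*-cong (≈-refl {x}) (x-* x)) (x-* (shift x))))
      (≈-trans (*-cong (≈-refl {constant a}) (x-* x)) (constant-* a (shift x))))
      (constant-* b x)) (≈-refl {constant c}))
    (exact (lemma₀ a b c) (lemma₁ a b c) (lemma₂ a b c))
    where
    lemma₀ : ∀ a b c →
      ℤ.- (c ℤ.* (1ℤ ℤ.- a ℤ.* 0ℤ)) ℤ.+ a ℤ.* (ℤ.- (c ℤ.* 0ℤ)) ℤ.+ b ℤ.* 0ℤ ℤ.+ c ≡ 0ℤ
    lemma₀ = solve-∀
    lemma₁ : ∀ a b c →
      (ℤ.- (c ℤ.* 0ℤ) ℤ.- b ℤ.* (1ℤ ℤ.- a ℤ.* 0ℤ)) ℤ.+ a ℤ.* (0ℤ ℤ.- b ℤ.* 0ℤ) ℤ.+ b ℤ.* 1ℤ ℤ.+ 0ℤ ≡ 0ℤ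
    lemma₁ = solve-∀
    lemma₂ : ∀ a b c →
      ((0ℤ ℤ.- b ℤ.* 0ℤ) ℤ.- a ℤ.* (1ℤ ℤ.- a ℤ.* 0ℤ)) ℤ.+ a ℤ.* (1ℤ ℤ.- a ℤ.* 0ℤ) ℤ.+ b ℤ.* 0ℤ ℤ.+ 0ℤ ≡ 0ℤ
    lemma₂ = solve-∀

  open Algebra.Properties.Semiring.Exp (CommutativeRing.semiring commutativeRing) using (_^_)

  power : ℕ → Residue
  power zero    = constant 1ℤ
  power (suc n) = shift (power n)

  x^≈power : ∀ n → x ^ n ≈ power n
  x^≈power zero    = ≈-refl
  x^≈power (suc n) = ≈-trans (*-cong (≈-refl {x}) (x^≈power n)) (x-* (power n))

  c₂-power : ∀ n → c₂ (power (suc n)) ≡ U a b c n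
  c₂-power 0 = lemma a
    where
    lemma : ∀ a → 0ℤ ℤ.- a ℤ.* 0ℤ ≡ 0ℤ
    lemma = solve-∀
  c₂-power 1 = lemma a b
    where
    lemma : ∀ a b → 1ℤ ℤ.- b ℤ.* 0ℤ ℤ.- a ℤ.* (0ℤ ℤ.- a ℤ.* 0ℤ) ≡ 1ℤ
    lemma = solve-∀
  c₂-power 2 = lemma a b c
    where
    lemma : ∀ a b c → ℤ.- (c ℤ.* 0ℤ) ℤ.- b ℤ.* (0ℤ ℤ.- a ℤ.* 0ℤ) ℤ.- a ℤ.* (1ℤ ℤ.- b ℤ.* 0ℤ ℤ.- a ℤ.* (0ℤ ℤ.- a ℤ.* 0ℤ)) ≡ ℤ.- a
    lemma = solve-∀
  c₂-power (suc (suc (suc n))) = ≡.trans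
    (lemma a b c (c₂ (power (suc n))) (c₂ (power (suc (suc n)))) (c₂ (power (suc (suc (suc n))))))
    (≡.cong₂ (λ r t₀ → ℤ.- (r ℤ.+ c ℤ.* t₀))
      (≡.cong₂ (λ t₂ t₁ → a ℤ.* t₂ ℤ.+ b ℤ.* t₁) (c₂-power (suc (suc n))) (c₂-power (suc n)))
      (c₂-power n))
    where
    lemma : ∀ a b c t₀ t₁ t₂ →
      ℤ.- (c ℤ.* t₀) ℤ.- b ℤ.* t₁ ℤ.- a ℤ.* t₂ ≡ ℤ.- (a ℤ.* t₂ ℤ.+ b ℤ.* t₁ ℤ.+ c ℤ.* t₀)
    lemma = solve-∀

  x^[1+n]≈ : ∀ n → ∃[ A ] ∃[ B ] x ^ suc n ≈ constant A + constant B * x + constant (U a b c n) * (x * x)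
  x^[1+n]≈ n = c₀ (power (suc n)) , c₁ (power (suc n)) , ≈-trans (x^≈power (suc n))
    (≈-trans
      (exact {power (suc n)} {⟨ c₀ (power (suc n)) , c₁ (power (suc n)) , U a b c n ⟩}
        ≡.refl ≡.refl (c₂-power n))
      (≈-sym (basis (c₀ (power (suc n))) (c₁ (power (suc n))) (U a b c n))))

open import Data.Integer.Base using (_+_; _-_; _*_; -_; _^_)
open ≡ using (refl; sym; trans; cong; cong₂; subst)

-- The Sylvester determinant as an expression of the ring solver

private
  module SymbolicDeterminant where

    open +-*-Solver

    Expr : Set
    Expr = Polynomial 3

    sumᵉ : ∀ {n} → (Fin n → Expr) → Expr
    sumᵉ {zero}  v = con 0ℤ
    sumᵉ {suc n} v = v Fin.zero :+ sumᵉ (v ∘ Fin.suc)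

    detᵉ : ∀ {n} → (Fin n → Fin n → Expr) → Expr
    detᵉ {zero}  M = con 1ℤ
    detᵉ {suc n} M =
      sumᵉ λ j → con (-1ℤ ^ toℕ j) :* (M Fin.zero j :* detᵉ λ i k → M (Fin.suc i) (punchIn j k))

    coeffᵉ : List Expr → ℕ → Expr
    coeffᵉ []      _       = con 0ℤ
    coeffᵉ (e ∷ _) zero    = e
    coeffᵉ (_ ∷ f) (suc k) = coeffᵉ f k

    sylvesterᵉ : ∀ n m → List Expr → List Expr → Fin (m ℕ.+ n) → Fin (m ℕ.+ n) → Expr
    sylvesterᵉ n m f g i j =
      coeffᵉ ([ shift f , shift g ]′ (splitAt m i)) (toℕ (opposite j))
      where
      shift : ∀ {k} → List Expr → Fin k → List Expr
      shift h l = List.replicate (toℕ (opposite l)) (con 0ℤ) ++ h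

    -- The coefficients of the derivative are left unsimplified: the two sides
    -- have to unfold to the same integer expression.
    discMonic-cubic : ∀ a b c → discMonic 3 (cubic a b c) ≡ discriminant a b c
    discMonic-cubic = solve 3 (λ a b c →
      con -1ℤ :* detᵉ (sylvesterᵉ 3 2
        (c ∷ b ∷ a ∷ con 1ℤ ∷ [])
        (con 1ℤ :* b ∷ con (+ 2) :* a ∷ con (+ 3) :* con 1ℤ ∷ [])) :=
      a :* a :* (b :* b) :- con (+ 4) :* (b :* b :* b) :- con (+ 4) :* (a :* a :* a :* c)
        :+ con (+ 18) :* (a :* b :* c) :- con (+ 27) :* (c :* c)) refl

open SymbolicDeterminant using (discMonic-cubic)

-- Roots modulo p and the values of U

cubic-derivative : ℤ → ℤ → ℤ → ℤ
cubic-derivative a b s = + 3 * (s * s) + + 2 * (a * s) + b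

module FrobeniusCriterion (n : ℕ) (p-prime : Prime (suc n)) (a b c : ℤ) where

  private
    p : ℕ
    p = suc n
    F = cubicℤ a b c
    Uₙ = U a b c n
    G = cubic-derivative a b

  open ResidueRing p a b c using (commutativeRing; constant-homomorphism; constant-p; x; x-root; independent; coordinates; x^[1+n]≈)
  module Ext = CubicExtension commutativeRing constant-homomorphism p-prime constant-p a b c x x-root independent

  no-roots : (∀ t → ¬ + p ∣ F t) →
    + p ∣ discriminant a b c * (Uₙ * Uₙ) - (a * a - + 3 * b) * (a * a - + 3 * b)
  no-roots rootless = Ext.frobenius-no-roots rootless coordinates {proj₁ (x^[1+n]≈ n)} {proj₁ (proj₂ (x^[1+n]≈ n))} {Uₙ}
    (proj₂ (proj₂ (x^[1+n]≈ n)))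

  one-root : ¬ + p ∣ + 2 → ∀ s → + p ∣ F s → (∀ t → + p ∣ F t → + p ∣ t - s) → ¬ + p ∣ G s →
    + p ∣ Uₙ * G s - (+ 3 * s + a)
  one-root p∤2 s p∣Fs unique p∤G = Ext.frobenius-one-root s p∣Fs unique p∤G p∤2
    {proj₁ (x^[1+n]≈ n)} {proj₁ (proj₂ (x^[1+n]≈ n))} {Uₙ} (proj₂ (proj₂ (x^[1+n]≈ n)))

  three-roots : ∀ s t r → + p ∣ F s → + p ∣ F t → + p ∣ F r →
    ¬ + p ∣ s - t → ¬ + p ∣ s - r → ¬ + p ∣ t - r → + p ∣ Uₙ
  three-roots s t r p∣Fs p∣Ft p∣Fr s≢t s≢r t≢r =
    [ id , ⊥-elim ∘ t≢r ]′ (prime∣* p-prime Uₙ (t - r)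
      (subst (+ p ∣_) (lemma₂ B Uₙ s t r) (∣m∣n⇒∣m-n (slope t s≢t p∣Ft) (slope r s≢r p∣Fr))))
    where
    A B : ℤ
    A = proj₁ (x^[1+n]≈ n)
    B = proj₁ (proj₂ (x^[1+n]≈ n))
    value : ∀ t → + p ∣ F t → + p ∣ A + B * t + Uₙ * (t * t) - t
    value = Ext.frobenius-at-root {A} {B} {Uₙ} (proj₂ (proj₂ (x^[1+n]≈ n)))
    lemma₁ : ∀ A B C s t →
      (A + B * s + C * (s * s) - s) - (A + B * t + C * (t * t) - t) ≡ (s - t) * (B + C * (s + t) - 1ℤ)
    lemma₁ = solve-∀
    lemma₂ : ∀ B C s t r → (B + C * (s + t) - 1ℤ) - (B + C * (s + r) - 1ℤ) ≡ C * (t - r)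
    lemma₂ = solve-∀
    slope : ∀ t → ¬ + p ∣ s - t → + p ∣ F t → + p ∣ B + Uₙ * (s + t) - 1ℤ
    slope t s≢t p∣Ft = [ ⊥-elim ∘ s≢t , id ]′ (prime∣* p-prime (s - t) (B + Uₙ * (s + t) - 1ℤ)
      (subst (+ p ∣_) (lemma₁ A B Uₙ s t) (∣m∣n⇒∣m-n (value s p∣Fs) (value t p∣Ft))))

  private
    -- the discriminant of f(x)/(x - s) if s is a root of f
    δ : ℤ → ℤ
    δ s = (s + a) * (s + a) - + 4 * (s * s + a * s + b)

    k : ℤ → ℤ
    k s = - (+ 27 * (c - (s * s * s + a * (s * s) + b * s))) + + 18 * (a * b) - + 4 * (a * a * a)

  discriminant-at : ∀ s → discriminant a b c ≡ δ s * (G s * G s) + k s * F s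
  discriminant-at s = lemma a b c s
    where
    lemma : ∀ a b c s →
      a * a * (b * b) - + 4 * (b * b * b) - + 4 * (a * a * a * c) + + 18 * (a * b * c) - + 27 * (c * c) ≡
      ((s + a) * (s + a) - + 4 * (s * s + a * s + b)) *
        ((+ 3 * (s * s) + + 2 * (a * s) + b) * (+ 3 * (s * s) + + 2 * (a * s) + b)) +
      (- (+ 27 * (c - (s * s * s + a * (s * s) + b * s))) + + 18 * (a * b) - + 4 * (a * a * a)) *
      (s * s * s + a * (s * s) + b * s + c)
    lemma = solve-∀

  simple-root : ¬ + p ∣ discriminant a b c → ∀ s → + p ∣ F s → ¬ + p ∣ G s
  simple-root p∤D s p∣Fs p∣Gs = p∤D (subst (+ p ∣_) (sym (discriminant-at s))
    (∣m∣n⇒∣m+n (∣n⇒∣m*n (δ s) (∣m⇒∣m*n (G s) p∣Gs)) (∣n⇒∣m*n (k s) p∣Fs)))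

  module OneRoot (p∤2 : ¬ + p ∣ + 2) (p∤D : ¬ + p ∣ discriminant a b c)
    (s : ℤ) (p∣Fs : + p ∣ F s) (unique : ∀ t → + p ∣ F t → + p ∣ t - s) where

    private
      D m : ℤ
      D = discriminant a b c
      m = + 3 * s + a

      p∤G : ¬ + p ∣ G s
      p∤G = simple-root p∤D s p∣Fs

    -- D ≡ δ g(s)² and U g(s) ≡ m give D U² ≡ δ m².
    DU²≡δm² : + p ∣ D * (Uₙ * Uₙ) - δ s * (m * m)
    DU²≡δm² = subst (+ p ∣_) (sym (trans (cong (λ d → d * (Uₙ * Uₙ) - δ s * (m * m)) (discriminant-at s))
        (lemma Uₙ (δ s) (G s) m (k s) (F s))))
      (∣m∣n⇒∣m+n (∣n⇒∣m*n (δ s * (Uₙ * G s + m)) (one-root p∤2 s p∣Fs unique p∤G))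
        (∣n⇒∣m*n (k s * (Uₙ * Uₙ)) p∣Fs))
      where
      lemma : ∀ U δ G m k F → (δ * (G * G) + k * F) * (U * U) - δ * (m * m) ≡
        δ * (U * G + m) * (U * G - m) + k * (U * U) * F
      lemma = solve-∀

    DU²≢q² : ∀ q → ¬ + p ∣ q → ¬ + p ∣ D * (Uₙ * Uₙ) - q * q
    DU²≢q² q p∤q d = Ext.δm²≢n² s p∣Fs unique p∤G p∤2 m q p∤m δm²≡q²
      where
      lemma : ∀ d e q → (d - q * q) - (d - e) ≡ e - q * q
      lemma = solve-∀
      δm²≡q² : + p ∣ δ s * (m * m) - q * q
      δm²≡q² = subst (+ p ∣_) (lemma (D * (Uₙ * Uₙ)) (δ s * (m * m)) q) (∣m∣n⇒∣m-n d DU²≡δm²)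
      lemma′ : ∀ δ m q → δ * m * m - (δ * (m * m) - q * q) ≡ q * q
      lemma′ = solve-∀
      p∤m : ¬ + p ∣ m
      p∤m p∣m = ∤*∤⇒∤ p-prime p∤q p∤q (subst (+ p ∣_) (lemma′ (δ s) m q)
        (∣m∣n⇒∣m-n (∣n⇒∣m*n (δ s * m) p∣m) δm²≡q²))

    DU²≢0 : let S = + 2 * (a * a * a) - + 9 * (a * b) + + 27 * c in
      (¬ + p ∣ S) ⊎ (∃[ r ] D ≡ r * r) → ¬ + p ∣ D * (Uₙ * Uₙ)
    DU²≢0 hyp d = [ (λ p∤S → p∤S p∣S)
        , (λ (r , D≡r²) → Ext.δm²≢n² s p∣Fs unique p∤G p∤2 (G s) r p∤G
            (subst (+ p ∣_) (lemma₁ (δ s * (G s * G s)) (k s * F s) r)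
              (subst (λ e → + p ∣ e - r * r - k s * F s) (discriminant-at s)
                (∣m∣n⇒∣m-n (subst (λ e → + p ∣ e - r * r) (sym D≡r²) (divides 0ℤ (ℤ.+-inverseʳ (r * r))))
                  (∣n⇒∣m*n (k s) p∣Fs)))))
        ]′ hyp
      where
      lemma₁ : ∀ d e r → d + e - r * r - e ≡ d - r * r
      lemma₁ = solve-∀
      p∣U : + p ∣ Uₙ
      p∣U = [ ⊥-elim ∘ p∤D , [ id , id ]′ ∘ prime∣* p-prime Uₙ Uₙ ]′ (prime∣* p-prime D (Uₙ * Uₙ) d)
      lemma₂ : ∀ u m → u - (u - m) ≡ m
      lemma₂ = solve-∀
      p∣m : + p ∣ m
      p∣m = subst (+ p ∣_) (lemma₂ (Uₙ * G s) m) (∣m∣n⇒∣m-n (∣m⇒∣m*n (G s) p∣U) (one-root p∤2 s p∣Fs unique p∤G))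
      lemma₃ : ∀ a b c s → let m = + 3 * s + a in
        + 27 * (s * s * s + a * (s * s) + b * s + c) - (m * m - + 3 * (a * a) + + 9 * b) * m ≡
        + 2 * (a * a * a) - + 9 * (a * b) + + 27 * c
      lemma₃ = solve-∀
      p∣S : + p ∣ + 2 * (a * a * a) - + 9 * (a * b) + + 27 * c
      p∣S = subst (+ p ∣_) (lemma₃ a b c s)
        (∣m∣n⇒∣m-n (∣n⇒∣m*n (+ 27) p∣Fs) (∣n⇒∣m*n (m * m - + 3 * (a * a) + + 9 * b) p∣m))

  module TwoRoots (p∤D : ¬ + p ∣ discriminant a b c)
    {s t : ℤ} (p∣Fs : + p ∣ F s) (p∣Ft : + p ∣ F t) (s≢t : ¬ + p ∣ s - t) where

    private
      r q : ℤ
      r = - a - s - t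
      q = t * t + (s + a) * t + (s * s + a * s + b)

    p∣q : + p ∣ q
    p∣q = [ ⊥-elim ∘ s≢t , id ]′ (prime∣* p-prime (s - t) q
      (subst (+ p ∣_) (lemma a b c s t) (∣m∣n⇒∣m-n p∣Fs p∣Ft)))
      where
      lemma : ∀ a b c s t →
        (s * s * s + a * (s * s) + b * s + c) - (t * t * t + a * (t * t) + b * t + c) ≡
        (s - t) * (t * t + (s + a) * t + (s * s + a * s + b))
      lemma = solve-∀

    F-splits : ∀ w → F w ≡ (w - s) * ((w - t) * (w - r)) + (F s + (w - s) * q)
    F-splits w = lemma a b c s t w
      where
      lemma : ∀ a b c s t w →
        w * w * w + a * (w * w) + b * w + c ≡
        (w - s) * ((w - t) * (w - (- a - s - t))) +
        ((s * s * s + a * (s * s) + b * s + c) + (w - s) * (t * t + (s + a) * t + (s * s + a * s + b)))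
      lemma = solve-∀

    p∣remainder : ∀ w → + p ∣ F s + (w - s) * q
    p∣remainder w = ∣m∣n⇒∣m+n p∣Fs (∣n⇒∣m*n (w - s) p∣q)

    third-root : + p ∣ F r
    third-root = subst (+ p ∣_) (sym (F-splits r))
      (∣m∣n⇒∣m+n (∣n⇒∣m*n (r - s) (∣n⇒∣m*n (r - t) (divides 0ℤ (ℤ.+-inverseʳ r)))) (p∣remainder r))

    other-root : ∀ w → + p ∣ F w → ¬ + p ∣ w - s → ¬ + p ∣ w - t → + p ∣ w - r
    other-root w p∣Fw w≢s w≢t =
      [ ⊥-elim ∘ w≢s , [ ⊥-elim ∘ w≢t , id ]′ ∘ prime∣* p-prime (w - t) (w - r) ]′
        (prime∣* p-prime (w - s) ((w - t) * (w - r))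
          (∣m+n∣n⇒∣m (subst (+ p ∣_) (F-splits w) p∣Fw) (p∣remainder w)))

    s≢r : ¬ + p ∣ s - r
    s≢r d = simple-root p∤D s p∣Fs (subst (+ p ∣_) (sym (lemma a b s t)) (∣m∣n⇒∣m+n (∣n⇒∣m*n (s - t) d) p∣q))
      where
      lemma : ∀ a b s t → + 3 * (s * s) + + 2 * (a * s) + b ≡
        (s - t) * (s - (- a - s - t)) + (t * t + (s + a) * t + (s * s + a * s + b))
      lemma = solve-∀

    t≢r : ¬ + p ∣ t - r
    t≢r d = simple-root p∤D t p∣Ft (subst (+ p ∣_) (sym (lemma a b s t)) (∣m∣n⇒∣m+n (∣n⇒∣m*n (t - s) d) p∣q))
      where
      lemma : ∀ a b s t → + 3 * (t * t) + + 2 * (a * t) + b ≡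
        (t - s) * (t - (- a - s - t)) + (t * t + (s + a) * t + (s * s + a * s + b))
      lemma = solve-∀

  data Splitting : ℕ → Set where
    irreducible : (∀ t → ¬ + p ∣ F t) → Splitting 0
    linear×quadratic : ∀ s → + p ∣ F s → (∀ t → + p ∣ F t → + p ∣ t - s) → Splitting 1
    split : ∀ s t r → + p ∣ F s → + p ∣ F t → + p ∣ F r →
      ¬ + p ∣ s - t → ¬ + p ∣ s - r → ¬ + p ∣ t - r → Splitting 3

  mod-injective : ∀ {i j} → i < p → j < p → + p ∣ + i - + j → i ≡ j
  mod-injective {i} {j} i<p j<p d with ℕ.<-cmp i j
  ... | tri≈ _ i≡j _ = i≡j
  ... | tri> _ _ j<i = ⊥-elim (<p⇒∤ p-prime (ℕ.m<n⇒0<n∸m j<i) (ℕ.≤-<-trans (ℕ.m∸n≤m i j) i<p)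
    (subst (+ p ∣_) (trans (ℤ.m-n≡m⊖n i j) (ℤ.⊖-≥ (ℕ.<⇒≤ j<i))) d))
  ... | tri< i<j _ _ = ⊥-elim (<p⇒∤ p-prime (ℕ.m<n⇒0<n∸m i<j) (ℕ.≤-<-trans (ℕ.m∸n≤m j i) j<p)
    (subst (+ p ∣_) (trans (ℤ.m-n≡m⊖n j i) (ℤ.⊖-≥ (ℕ.<⇒≤ i<j)))
      (subst (+ p ∣_) (lemma (+ i) (+ j)) (∣m⇒∣-m d))))
    where
    lemma : ∀ i j → - (i - j) ≡ j - i
    lemma = solve-∀

  F-mod : ∀ {t w} → t ≡ w [mod p ] → + p ∣ F t → + p ∣ F w
  F-mod {t} {w} d p∣Ft = subst (+ p ∣_) (lemma a b c t w)
    (∣m∣n⇒∣m-n p∣Ft (∣m⇒∣m*n (t * t + t * w + w * w + a * (t + w) + b) d))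
    where
    lemma : ∀ a b c t w →
      (t * t * t + a * (t * t) + b * t + c) - (t - w) * (t * t + t * w + w * w + a * (t + w) + b) ≡
      w * w * w + a * (w * w) + b * w + c
    lemma = solve-∀

  splitting : ¬ + p ∣ discriminant a b c → ∀ rs → Unique rs →
    All (λ i → i < p × + p ∣ F (+ i)) rs →
    (∀ i → i < p → + p ∣ F (+ i) → i ∈ rs) → Splitting (length rs)
  splitting p∤D [] _ _ complete = irreducible λ t p∣Ft → case-residue t p∣Ft (residue p-prime t)
    where
    case-residue : ∀ t → + p ∣ F t → ∃[ i ] (i < p × t ≡ + i [mod p ]) → ⊥
    case-residue t p∣Ft (i , i<p , t≡i) with () ← complete i i<p (F-mod {t} {+ i} t≡i p∣Ft)
  splitting p∤D (i ∷ []) _ ((i<p , p∣Fi) ∷ []) complete = linear×quadratic (+ i) p∣Fi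
    λ t p∣Ft → case-residue t p∣Ft (residue p-prime t)
    where
    case-residue : ∀ t → + p ∣ F t → ∃[ j ] (j < p × t ≡ + j [mod p ]) → + p ∣ t - + i
    case-residue t p∣Ft (j , j<p , t≡j) with complete j j<p (F-mod {t} {+ j} t≡j p∣Ft)
    ... | here refl = t≡j
  splitting p∤D (i ∷ j ∷ ks) ((i≢j ∷ i≢ks) ∷ j≢ks ∷ ks-unique) ((i<p , p∣Fi) ∷ (j<p , p∣Fj) ∷ ks-roots) complete =
    go ks i≢ks j≢ks ks-unique ks-roots third∈
    where
    incongruent : ∀ {i j} → i < p → j < p → i ≢ j → ¬ + p ∣ + i - + j
    incongruent i<p j<p i≢j d = i≢j (mod-injective i<p j<p d)

    module T = TwoRoots p∤D {+ i} {+ j} p∣Fi p∣Fj (incongruent i<p j<p i≢j)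
    r : ℤ
    r = - a - + i - + j

    third∈ : ∃[ k ] (k < p × (r ≡ + k [mod p ]) × k ∈ (i ∷ j ∷ ks))
    third∈ with k , k<p , r≡k ← residue p-prime r = k , k<p , r≡k , complete k k<p (F-mod {r} {+ k} r≡k T.third-root)

    go : ∀ ks → All (i ≢_) ks → All (j ≢_) ks → Unique ks → All (λ k → k < p × + p ∣ F (+ k)) ks →
      ∃[ k ] (k < p × (r ≡ + k [mod p ]) × k ∈ (i ∷ j ∷ ks)) → Splitting (suc (suc (length ks)))
    go ks _ _ _ _ (k , _ , r≡k , here refl) = ⊥-elim (T.s≢r (mod-sym {p} {r} {+ k} r≡k))
    go ks _ _ _ _ (k , _ , r≡k , there (here refl)) = ⊥-elim (T.t≢r (mod-sym {p} {r} {+ k} r≡k))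
    go (k ∷ []) _ _ _ _ _ =
      split (+ i) (+ j) r p∣Fi p∣Fj T.third-root (incongruent i<p j<p i≢j) T.s≢r T.t≢r
    go (k ∷ l ∷ _) (i≢k ∷ i≢l ∷ _) (j≢k ∷ j≢l ∷ _) ((k≢l ∷ _) ∷ _) ((k<p , p∣Fk) ∷ (l<p , p∣Fl) ∷ _) _ =
      ⊥-elim (k≢l (mod-injective k<p l<p (mod-trans {p} {+ k} {r} {+ l}
        (third k<p p∣Fk i≢k j≢k) (mod-sym {p} {+ l} {r} (third l<p p∣Fl i≢l j≢l)))))
      where
      third : ∀ {k} → k < p → + p ∣ F (+ k) → i ≢ k → j ≢ k → + p ∣ + k - r
      third {k} k<p p∣Fk i≢k j≢k = T.other-root (+ k) p∣Fk
        (incongruent k<p i<p (i≢k ∘ sym)) (incongruent k<p j<p (j≢k ∘ sym))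

  eval-cubic : ∀ t → eval (cubic a b c) t ≡ F t
  eval-cubic t = lemma a b c t
    where
    lemma : ∀ a b c t → c + t * (b + t * (a + t * (1ℤ + t * 0ℤ))) ≡ t * t * t + a * (t * t) + b * t + c
    lemma = solve-∀

  N-splitting : ¬ + p ∣ discriminant a b c → Splitting (N p (cubic a b c))
  N-splitting p∤D = splitting p∤D (filter root? (upTo p))
    (Unique.filter⁺ root? (Unique.upTo⁺ p))
    (All.zip (filter⁺ root? (applyUpTo⁺₁ id p id) , All.map (λ {i} → to {i}) (all-filter root? (upTo p))))
    (λ i i<p p∣Fi → ∈-filter⁺ root? (∈-upTo⁺ i<p) (from {i} p∣Fi))
    where
    root? = λ i → eval (cubic a b c) (+ i) ≡? 0ℤ [mod p ]
    to : ∀ {i} → eval (cubic a b c) (+ i) ≡ 0ℤ [mod p ] → + p ∣ F (+ i)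
    to {i} d = subst (+ p ∣_) (trans (ℤ.+-identityʳ _) (eval-cubic (+ i))) d
    from : ∀ {i} → + p ∣ F (+ i) → eval (cubic a b c) (+ i) ≡ 0ℤ [mod p ]
    from {i} d = subst (+ p ∣_) (sym (trans (ℤ.+-identityʳ _) (eval-cubic (+ i)))) d

  criterion : ¬ + p ∣ + 2 → ¬ + p ∣ discriminant a b c → ¬ + p ∣ a * a - + 3 * b →
    (¬ + p ∣ + 2 * (a * a * a) - + 9 * (a * b) + + 27 * c) ⊎ (∃[ r ] discriminant a b c ≡ r * r) →
    let D = discriminant a b c
        q = a * a - + 3 * b in
    (+ p ∣ D * (Uₙ * Uₙ) → N p (cubic a b c) ≡ 3) ×
    (+ p ∣ D * (Uₙ * Uₙ) - q * q → N p (cubic a b c) ≡ 0) ×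
    (¬ + p ∣ D * (Uₙ * Uₙ) → ¬ + p ∣ D * (Uₙ * Uₙ) - q * q → N p (cubic a b c) ≡ 1)
  criterion p∤2 p∤D p∤q symmetric = go (N-splitting p∤D)
    where
    D q : ℤ
    D = discriminant a b c
    q = a * a - + 3 * b
    lemma : ∀ d e → d - (d - e) ≡ e
    lemma = solve-∀
    exclusive : + p ∣ D * (Uₙ * Uₙ) → ¬ + p ∣ D * (Uₙ * Uₙ) - q * q
    exclusive d e = ∤*∤⇒∤ p-prime p∤q p∤q (subst (+ p ∣_) (lemma (D * (Uₙ * Uₙ)) (q * q)) (∣m∣n⇒∣m-n d e))
    go : ∀ {k} → Splitting k →
      (+ p ∣ D * (Uₙ * Uₙ) → k ≡ 3) ×
      (+ p ∣ D * (Uₙ * Uₙ) - q * q → k ≡ 0) ×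
      (¬ + p ∣ D * (Uₙ * Uₙ) → ¬ + p ∣ D * (Uₙ * Uₙ) - q * q → k ≡ 1)
    go (irreducible rootless) =
      (λ d → ⊥-elim (exclusive d (no-roots rootless))) , (λ _ → refl) , (λ _ e → ⊥-elim (e (no-roots rootless)))
    go (linear×quadratic s p∣Fs unique) =
      (λ d → ⊥-elim (DU²≢0 symmetric d)) , (λ e → ⊥-elim (DU²≢q² q p∤q e)) , (λ _ _ → refl)
      where open OneRoot p∤2 p∤D s p∣Fs unique
    go (split s t r p∣Fs p∣Ft p∣Fr s≢t s≢r t≢r) =
      (λ _ → refl) , (λ e → ⊥-elim (exclusive p∣DU² e)) , (λ d _ → ⊥-elim (d p∣DU²))
      where
      p∣DU² : + p ∣ D * (Uₙ * Uₙ)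
      p∣DU² = ∣n⇒∣m*n D (∣m⇒∣m*n Uₙ (three-roots s t r p∣Fs p∣Ft p∣Fr s≢t s≢r t≢r))

private
  i^2≡i*i : ∀ i → i ^ 2 ≡ i * i
  i^2≡i*i i = cong (i *_) (ℤ.*-identityʳ i)

  symmetry-≡ : ∀ a b c → + 2 * a ^ 3 - + 9 * a * b + + 27 * c ≡ + 2 * (a * a * a) - + 9 * (a * b) + + 27 * c
  symmetry-≡ = lemma
    where
    lemma : ∀ a b c → + 2 * (a * (a * (a * 1ℤ))) - + 9 * a * b + + 27 * c ≡ + 2 * (a * a * a) - + 9 * (a * b) + + 27 * c
    lemma = solve-∀

∣i∣<p⇒∤ : ∀ {p i} → i ≢ 0ℤ → ∣ i ∣ < p → ¬ + p ∣ i
∣i∣<p⇒∤ i≢0 i<p d = ℕ.<⇒≱ i<p (ℕ∣.∣⇒≤ (∣⇒∣ᵤ d))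
  where instance _ = ℤ.≢-nonZero i≢0

∉upTo⇒≥ : ∀ {m n} → m ∉ upTo n → n ≤ m
∉upTo⇒≥ m∉ = ℕ.≮⇒≥ (m∉ ∘ ∈-upTo⁺)

module _ (a b c D : ℤ) (D≡ : D ≡ discriminant a b c) (D≢0 : D ≢ 0ℤ) (q≢0 : a ^ 2 - + 3 * b ≢ 0ℤ)
  (symmetric : + 2 * a ^ 3 - + 9 * a * b + + 27 * c ≡ 0ℤ → ∃[ r ] D ≡ r ^ 2) where

  private
    q S : ℤ
    q = a ^ 2 - + 3 * b
    S = + 2 * a ^ 3 - + 9 * a * b + + 27 * c

    bound : ℕ
    bound = suc (2 ℕ.+ ∣ D ∣ ℕ.+ ∣ q ∣ ℕ.+ ∣ S ∣)

  criterion-above : ∀ p → Prime p → bound ≤ p → let u = U a b c (p ∸ 1) in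
    (D * u ^ 2 ≡ 0ℤ [mod p ] → N p (cubic a b c) ≡ 3) ×
    (D * u ^ 2 ≡ q ^ 2 [mod p ] → N p (cubic a b c) ≡ 0) ×
    (¬ D * u ^ 2 ≡ 0ℤ [mod p ] → ¬ D * u ^ 2 ≡ q ^ 2 [mod p ] → N p (cubic a b c) ≡ 1)
  criterion-above (suc n) p-prime bound≤p =
    proj₁ result ∘ subst (+ suc n ∣_) three≡ ,
    proj₁ (proj₂ result) ∘ subst (+ suc n ∣_) none≡ ,
    λ ¬three ¬none → proj₂ (proj₂ result)
      (¬three ∘ subst (+ suc n ∣_) (sym three≡)) (¬none ∘ subst (+ suc n ∣_) (sym none≡))
    where
    u : ℤ
    u = U a b c n

    2<p : 2 < suc n
    2<p = ℕ.≤-trans (s≤s (ℕ.≤-trans (ℕ.m≤m+n 2 ∣ D ∣) (ℕ.≤-trans (ℕ.m≤m+n _ ∣ q ∣) (ℕ.m≤m+n _ ∣ S ∣)))) bound≤p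
    ∣D∣<p : ∣ D ∣ < suc n
    ∣D∣<p = ℕ.≤-trans (s≤s (ℕ.≤-trans (ℕ.m≤n+m ∣ D ∣ 2) (ℕ.≤-trans (ℕ.m≤m+n _ ∣ q ∣) (ℕ.m≤m+n _ ∣ S ∣)))) bound≤p
    ∣q∣<p : ∣ q ∣ < suc n
    ∣q∣<p = ℕ.≤-trans (s≤s (ℕ.≤-trans (ℕ.m≤n+m ∣ q ∣ (2 ℕ.+ ∣ D ∣)) (ℕ.m≤m+n _ ∣ S ∣))) bound≤p
    ∣S∣<p : ∣ S ∣ < suc n
    ∣S∣<p = ℕ.≤-trans (s≤s (ℕ.m≤n+m ∣ S ∣ (2 ℕ.+ ∣ D ∣ ℕ.+ ∣ q ∣))) bound≤p

    q≡ : q ≡ a * a - + 3 * b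
    q≡ = cong (_- + 3 * b) (i^2≡i*i a)

    symmetric′ : (¬ + suc n ∣ + 2 * (a * a * a) - + 9 * (a * b) + + 27 * c) ⊎ (∃[ r ] discriminant a b c ≡ r * r)
    symmetric′ with S ℤ.≟ 0ℤ
    ... | no  S≢0 = inj₁ (∣i∣<p⇒∤ S≢0 ∣S∣<p ∘ subst (+ suc n ∣_) (sym (symmetry-≡ a b c)))
    ... | yes S≡0 with r , D≡r² ← symmetric S≡0 = inj₂ (r , trans (sym D≡) (trans D≡r² (i^2≡i*i r)))

    open FrobeniusCriterion n p-prime a b c
    result = criterion (<p⇒∤ p-prime (s≤s z≤n) 2<p)
      (∣i∣<p⇒∤ D≢0 ∣D∣<p ∘ subst (+ suc n ∣_) (sym D≡))
      (∣i∣<p⇒∤ q≢0 ∣q∣<p ∘ subst (+ suc n ∣_) (sym q≡))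
      symmetric′

    DU²≡ : D * u ^ 2 ≡ discriminant a b c * (u * u)
    DU²≡ = trans (cong (_* u ^ 2) D≡) (cong (discriminant a b c *_) (i^2≡i*i u))
    three≡ : D * u ^ 2 - 0ℤ ≡ discriminant a b c * (u * u)
    three≡ = trans (ℤ.+-identityʳ _) DU²≡
    none≡ : D * u ^ 2 - q ^ 2 ≡ discriminant a b c * (u * u) - (a * a - + 3 * b) * (a * a - + 3 * b)
    none≡ = trans (cong (_- q ^ 2) DU²≡)
      (cong (λ e → discriminant a b c * (u * u) - e) (trans (i^2≡i*i q) (cong (λ e → e * e) q≡)))

theorem7 : (a₁ a₂ a₃ : ℤ) → Nondegenerate a₁ a₂ a₃ →
    let f = cubic a₁ a₂ a₃
        D = discMonic 3 f
        threeRoots = λ (p : ℕ) → D * U a₁ a₂ a₃ (p ∸ 1) ^ 2 ≡ 0ℤ [mod p ]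
        noRoots = λ (p : ℕ) → D * U a₁ a₂ a₃ (p ∸ 1) ^ 2 ≡ (a₁ ^ 2 - + 3 * a₂) ^ 2 [mod p ]
    in
    ∃[ exceptions ] ((p : ℕ) → Prime p → p ∉ exceptions →
      (threeRoots p → N p f ≡ 3) ×
      (noRoots p → N p f ≡ 0) ×
      (¬ threeRoots p → ¬ noRoots p → N p f ≡ 1))
theorem7 a₁ a₂ a₃ nondegenerate = upTo _ , λ p p-prime p∉ →
  criterion-above a₁ a₂ a₃ (discMonic 3 (cubic a₁ a₂ a₃)) (discMonic-cubic a₁ a₂ a₃)
    disc≢0 a₁²≢3a₂ symmetric p p-prime (∉upTo⇒≥ p∉)
  where open Nondegenerate nondegenerate
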